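{- Let $M(x,y)=\sum_{n\ge1}\sum_{\sigma\in S_n(T_2)}x^ny^{asc(\sigma)}$, and let $N(x,y)=\sum_{P}x^{|P|/2}y^{peak(P)}$ be the Narayana generating function, the sum ranging over all Dyck paths $P$ (including the empty path). Then $$M(x,y)=\frac{x\,N(x,y)}{1-xN(x,y)^2}.$$
   Context: A permutation $\sigma$ avoids $\tau$ if no subsequence of $\sigma$ has the same relative order as $\tau$. $T_2=\{3124,3142,4123,4132\}$ and $S_n(T_2)$ is the set of permutations in $S_n$ avoiding all four patterns. $asc(\sigma)$ is the number of positions $i$ with $\sigma(i)<\sigma(i+1)$. A Dyck path is a lattice path from the origin with steps $U=(1,1)$, $D=(1,-1)$ never going below the $x$-axis and ending on it; $|P|$ is its length and $peak(P)$ the number of occurrences of the factor $UD$. -}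

module Defs where

open import Data.Nat using (ℕ; zero; suc; _+_; _*_; _∸_; _<ᵇ_; _≡ᵇ_)
open import Data.Bool using (Bool; true; false; _∧_; _∨_; not; if_then_else_)
open import Data.List using (List; []; _∷_; map; concatMap; length; filter; upTo; zipWith; _++_)
open import Data.Bool.ListAction using (and; any; all)
open import Data.List.Relation.Unary.Unique.Propositional using (Unique)
open import Data.Product using (_×_; _,_)
open import Relation.Binary.PropositionalEquality using (_≡_)

words : ℕ → ℕ → List (List ℕ)
words zero    m = [] ∷ []
words (suc k) m = concatMap (λ a → map (a ∷_) (words k m)) (upTo m)

notIn : ℕ → List ℕ → Bool
notIn a []       = true
notIn a (b ∷ bs) = not (a ≡ᵇ b) ∧ notIn a bs

distinct : List ℕ → Bool
distinct []       = true
distinct (a ∷ as) = notIn a as ∧ distinct as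

perms : ℕ → List (List ℕ)
perms n = filter (λ w → distinct w Data.Bool.≟ true) (words n n)

subseqs : ℕ → List ℕ → List (List ℕ)
subseqs zero    _        = [] ∷ []
subseqs (suc k) []       = []
subseqs (suc k) (a ∷ as) = map (a ∷_) (subseqs k as) ++ subseqs (suc k) as

pairs : List ℕ → List (ℕ × ℕ)
pairs []       = []
pairs (a ∷ as) = map (λ b → (a , b)) as ++ pairs as

-- s and t have the same relative order (for lists of distinct entries):
-- same length and for all i<j, s_i < s_j iff t_i < t_j
sameOrder : List ℕ → List ℕ → Bool
sameOrder s t =
  (length s ≡ᵇ length t) ∧
  and (zipWith (λ p q → eqB (lt p) (lt q)) (pairs s) (pairs t))
  where
  lt : ℕ × ℕ → Bool
  lt (a , b) = a <ᵇ b
  eqB : Bool → Bool → Bool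
  eqB true  true  = true
  eqB false false = true
  eqB _     _     = false

contains : List ℕ → List ℕ → Bool
contains σ τ = any (λ s → sameOrder s τ) (subseqs (length τ) σ)

avoidsAll : List (List ℕ) → List ℕ → Bool
avoidsAll ts σ = all (λ τ → not (contains σ τ)) ts

T₂ : List (List ℕ)
T₂ = (3 ∷ 1 ∷ 2 ∷ 4 ∷ []) ∷ (3 ∷ 1 ∷ 4 ∷ 2 ∷ []) ∷
     (4 ∷ 1 ∷ 2 ∷ 3 ∷ []) ∷ (4 ∷ 1 ∷ 3 ∷ 2 ∷ []) ∷ []

avoiders : ℕ → List (List ℕ)
avoiders n = filter (λ σ → avoidsAll T₂ σ Data.Bool.≟ true) (perms n)

asc : List ℕ → ℕ
asc []           = 0
asc (a ∷ [])     = 0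
asc (a ∷ b ∷ as) = (if a <ᵇ b then 1 else 0) + asc (b ∷ as)

data Step : Set where
  U D : Step

allSteps : ℕ → List (List Step)
allSteps zero    = [] ∷ []
allSteps (suc k) = concatMap (λ w → (U ∷ w) ∷ (D ∷ w) ∷ []) (allSteps k)

dyckFrom : ℕ → List Step → Bool
dyckFrom zero    []      = true
dyckFrom (suc h) []      = false
dyckFrom h       (U ∷ p) = dyckFrom (suc h) p
dyckFrom zero    (D ∷ p) = false
dyckFrom (suc h) (D ∷ p) = dyckFrom h p

isDyck : List Step → Bool
isDyck = dyckFrom 0

dyckPaths : ℕ → List (List Step)
dyckPaths n = filter (λ p → isDyck p Data.Bool.≟ true) (allSteps (n + n))

peak : List Step → ℕ
peak []           = 0
peak (U ∷ D ∷ p)  = suc (peak (D ∷ p))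
peak (_ ∷ p)      = peak p

-- Formal power series in x , y with natural coefficients:
-- f n k is the coefficient of x^n y^k.

Series : Set
Series = ℕ → ℕ → ℕ

sumTo : ℕ → (ℕ → ℕ) → ℕ
sumTo zero    f = f 0
sumTo (suc n) f = sumTo n f + f (suc n)

_⊕_ : Series → Series → Series
(f ⊕ g) n k = f n k + g n k

_⊛_ : Series → Series → Series
(f ⊛ g) n k = sumTo n (λ i → sumTo k (λ j → f i j * g (n ∸ i) (k ∸ j)))

X· : Series → Series
X· f zero    k = 0
X· f (suc n) k = f n k

count : {A : Set} → (A → Bool) → List A → ℕ
count p []       = 0
count p (a ∷ as) = (if p a then 1 else 0) + count p as

M : Series
M zero    k = 0
M (suc n) k = count (λ σ → asc σ ≡ᵇ k) (avoiders (suc n))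

N : Series
N n k = count (λ P → peak P ≡ᵇ k) (dyckPaths n)

_≈_ : Series → Series → Set
f ≈ g = ∀ n k → f n k ≡ g n k

{-# OPTIONS --safe #-}

-- Split a permutation σ = A m B at its minimum m.  Apart from the patterns already present in A B,
-- σ contains a pattern of T₂ exactly when B has at least two letters, one of them below a letter
-- of A.  So for |B| ≤ 1 the word A B is an arbitrary avoider, while for |B| ≥ 2 all of A lies below
-- B, A avoids 312 and B is an arbitrary avoider.  The ascents of 312-avoiders obey the
-- first-return recurrence of the peaks of Dyck paths, so they are counted by N.
--
-- Let P and Q count the avoiders ending in an ascent and in a descent, and put K = N − 1.  Then
--   M = x + P + Q,   Q = x M + x (y + K) Q,   P = x (y x + P + y Q) + x (y + K) P,
-- and K = x (y + K) N shows that 1 / (1 − x (y + K)) = N.  Hence Q = x N M, P = K (x + Q) and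
-- M = N (x + Q) = x N + x N² M.

module Submission where

open import Defs hiding (_≈_)
open import Algebra.Bundles using (CommutativeSemiring)
import Algebra.Properties.CommutativeSemigroup
import Algebra.Solver.Ring.NaturalCoefficients.Default as Solver
open import Algebra.Structures.Biased using (isCommutativeSemiringˡ)
open import Data.Bool using (Bool; true; false; not; if_then_else_; T) renaming (_≟_ to _≟ᵇ_)
open import Data.Bool.ListAction using (any; all)
open import Data.Empty using (⊥)
open import Data.List
  using (List; []; _∷_; _++_; map; concatMap; length; filter; upTo; cartesianProductWith)
open import Data.List.Properties using (∷-injective; ∷-injectiveˡ; ∷-injectiveʳ; length-++; ++-identityʳ)
open import Data.Nat as Nat
  using (ℕ; zero; suc; _∸_; _≤_; _<_; _≡ᵇ_; _<ᵇ_; _≟_; _≤?_; _<?_; z≤n; s≤s)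
open import Data.List.Membership.DecPropositional _≟_ using (_∈?_)
open import Data.List.Membership.Propositional using (_∈_; find; lose)
open import Data.List.Membership.Propositional.Properties
  using (∈-++⁺ˡ; ∈-++⁺ʳ; ∈-++⁻; ∈-∃++; ∈-map⁺; ∈-map⁻; ∈-concatMap⁺; ∈-concatMap⁻; ∈-filter⁺; ∈-filter⁻;
         ∈-upTo⁺; ∈-upTo⁻; ∈-cartesianProductWith⁺; ∈-cartesianProductWith⁻)
open import Data.List.Membership.Propositional.Properties.WithK using (unique∧set⇒bag)
open import Data.List.Relation.Binary.BagAndSetEquality using (∼bag⇒↭)
open import Data.List.Relation.Binary.Permutation.Propositional as ↭ using (_↭_; ↭-sym; ↭⇒↭ₛ)
open import Data.List.Relation.Binary.Permutation.Propositional.Properties using (↭-length; All-resp-↭; shift)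
import Data.List.Relation.Binary.Permutation.Setoid.Properties as ↭ₛ
open import Data.List.Relation.Binary.Sublist.Propositional
  using (_⊆_; []; _∷_; _∷ʳ_; ⊆-refl; ⊆-trans; minimum; to∈; from∈; lookup)
open import Data.List.Relation.Binary.Sublist.Propositional.Properties using (++⁺; ++⁺ˡ; ++⁺ʳ; length-mono-≤)
open import Data.List.Relation.Unary.All as All using (All; []; _∷_)
import Data.List.Relation.Unary.All.Properties as All
open import Data.List.Relation.Unary.AllPairs using ([]; _∷_)
open import Data.List.Relation.Unary.Any using (here; there)
open import Data.List.Relation.Unary.Unique.DecPropositional _≟_ using (unique?)
open import Data.List.Relation.Unary.Unique.Propositional using (Unique)
import Data.List.Relation.Unary.Unique.Propositional.Properties as Unique
open import Data.Maybe using (Maybe; just; nothing)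
open import Data.Maybe.Properties using (≡-dec; just-injective)
open import Data.Nat.Properties as Natₚ
  using (≤-refl; ≤-trans; ≤-antisym; ≤-pred; ≤∧≢⇒<; <⇒≤; <⇒≱; <⇒≢; <-irrefl; <-asym; <-≤-trans; ≤-<-trans;
         <-≤-connex; n<1+n; m≤n⇒m≤1+n; m≤m+n; m<m+n; m+[n∸m]≡n; m∸n+n≡m; suc-injective; 0≢1+n;
         ≡ᵇ⇒≡; ≡⇒≡ᵇ; <⇒<ᵇ; <ᵇ⇒<; +-*-commutativeSemiring; module ≤-Reasoning)
open import Data.Product using (_×_; _,_; ∃-syntax; proj₁; proj₂; uncurry)
open import Data.Sum using (_⊎_; inj₁; inj₂; [_,_]′)
open import Function using (_∘_; mk⇔)
open import Level using (0ℓ)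
import Relation.Binary.PropositionalEquality as ≡
open ≡ using (_≡_; _≢_; cong; cong₂; subst; subst₂)
import Relation.Binary.Reasoning.Setoid as SetoidReasoning
open import Relation.Binary.Structures using (IsEquivalence)
open import Relation.Nullary using (Dec; yes; no; contradiction; _×-dec_)

-- Power series

-- All coefficients are naturals, so nothing is subtracted or inverted: dividing by 1 - x (y + K)
-- becomes uniqueness of the solution of f = h + x g f, and the theorem is proved with its
-- denominator cleared. Avoiders are sorted by their last step because of the case |B| = 1. A
-- minimum put just before the last letter replaces the last step by a descent and an ascent, so an
-- ascent is gained only if the old last step was a descent. Deleting the minimum and cutting a word
-- into blocks leaves words on intervals that no longer start at 0. Letters are never relabelled:
-- every family is indexed by its least letter l, and independence of l is read off from recurrences
-- in which l does not occur.

module PowerSeries (R : CommutativeSemiring 0ℓ 0ℓ) where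
  open CommutativeSemiring R
  open SetoidReasoning setoid
  open Algebra.Properties.CommutativeSemigroup +-commutativeSemigroup using (interchange)

  infixl 7 _✶_
  infixl 6 _∔_
  infix  4 _≋_

  _≋_ : (f g : ℕ → Carrier) → Set
  f ≋ g = ∀ n → f n ≈ g n

  _∔_ : (f g : ℕ → Carrier) → ℕ → Carrier
  (f ∔ g) n = f n + g n

  -- The Cauchy product, peeled at the constant term of the left factor. This form is structurally
  -- recursive and has no truncated subtraction in an index; it is matched with `_⊛_` afterwards.
  _✶_ : (f g : ℕ → Carrier) → ℕ → Carrier
  (f ✶ g) zero    = f 0 * g 0
  (f ✶ g) (suc n) = f 0 * g (suc n) + ((λ i → f (suc i)) ✶ g) n

  const : Carrier → ℕ → Carrier
  const c zero    = c
  const c (suc n) = 0#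

  X : ℕ → Carrier
  X zero    = 0#
  X (suc n) = const 1# n

  ✶-cong : ∀ {f f′ g g′} → f ≋ f′ → g ≋ g′ → f ✶ g ≋ f′ ✶ g′
  ✶-cong p q zero    = *-cong (p 0) (q 0)
  ✶-cong p q (suc n) = +-cong (*-cong (p 0) (q (suc n))) (✶-cong (λ i → p (suc i)) q n)

  ✶-distribʳ : ∀ h f g → (f ∔ g) ✶ h ≋ f ✶ h ∔ g ✶ h
  ✶-distribʳ h f g zero    = distribʳ _ _ _
  ✶-distribʳ h f g (suc n) =
    trans (+-cong (distribʳ _ _ _) (✶-distribʳ h _ _ n)) (interchange _ _ _ _)

  *-✶-assoc : ∀ c f g → (λ i → c * f i) ✶ g ≋ λ n → c * (f ✶ g) n
  *-✶-assoc c f g zero    = *-assoc _ _ _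
  *-✶-assoc c f g (suc n) =
    trans (+-cong (*-assoc _ _ _) (*-✶-assoc c _ g n)) (sym (distribˡ _ _ _))

  ✶-zeroˡ : ∀ g → (λ _ → 0#) ✶ g ≋ λ _ → 0#
  ✶-zeroˡ g zero    = zeroˡ _
  ✶-zeroˡ g (suc n) = trans (+-cong (zeroˡ _) (✶-zeroˡ g n)) (+-identityˡ 0#)

  const-✶ : ∀ c g → const c ✶ g ≋ λ n → c * g n
  const-✶ c g zero    = refl
  const-✶ c g (suc n) = trans (+-congˡ (✶-zeroˡ g n)) (+-identityʳ _)

  -- The mirror image of the defining equation, with the constant term of the right factor split
  -- off; commutativity compares the two.
  ✶-suc : ∀ f g n → (f ✶ g) (suc n) ≈ (f ✶ λ i → g (suc i)) n + f (suc n) * g 0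
  ✶-suc f g zero    = refl
  ✶-suc f g (suc n) = trans (+-congˡ (✶-suc (λ i → f (suc i)) g n)) (sym (+-assoc _ _ _))

  ✶-comm : ∀ f g → f ✶ g ≋ g ✶ f
  ✶-comm f g zero    = *-comm _ _
  ✶-comm f g (suc n) = begin
    f 0 * g (suc n) + ((λ i → f (suc i)) ✶ g) n ≈⟨ +-comm _ _ ⟩
    ((λ i → f (suc i)) ✶ g) n + f 0 * g (suc n) ≈⟨ +-cong (✶-comm _ g n) (*-comm _ _) ⟩
    (g ✶ λ i → f (suc i)) n + g (suc n) * f 0   ≈⟨ ✶-suc g f n ⟨
    (g ✶ f) (suc n)                             ∎

  ✶-assoc : ∀ f g h → (f ✶ g) ✶ h ≋ f ✶ (g ✶ h)
  ✶-assoc f g h zero    = *-assoc _ _ _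
  ✶-assoc f g h (suc n) = begin
    f 0 * g 0 * h (suc n) + ((λ i → (f ✶ g) (suc i)) ✶ h) n
      ≈⟨ +-congˡ (✶-distribʳ h _ _ n) ⟩
    f 0 * g 0 * h (suc n) + (((λ i → f 0 * g (suc i)) ✶ h) n + (((λ i → f (suc i)) ✶ g) ✶ h) n)
      ≈⟨ +-cong (*-assoc _ _ _) (+-cong (*-✶-assoc (f 0) _ h n) (✶-assoc _ g h n)) ⟩
    f 0 * (g 0 * h (suc n)) + (f 0 * ((λ i → g (suc i)) ✶ h) n + ((λ i → f (suc i)) ✶ (g ✶ h)) n)
      ≈⟨ +-assoc _ _ _ ⟨
    f 0 * (g 0 * h (suc n)) + f 0 * ((λ i → g (suc i)) ✶ h) n + ((λ i → f (suc i)) ✶ (g ✶ h)) n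
      ≈⟨ +-congʳ (distribˡ _ _ _) ⟨
    (f ✶ (g ✶ h)) (suc n) ∎

  X-✶-zero : ∀ f → (X ✶ f) 0 ≈ 0#
  X-✶-zero f = zeroˡ _

  X-✶-suc : ∀ f n → (X ✶ f) (suc n) ≈ f n
  X-✶-suc f n = begin
    0# * f (suc n) + (const 1# ✶ f) n ≈⟨ +-cong (zeroˡ _) (const-✶ 1# f n) ⟩
    0# + 1# * f n                     ≈⟨ +-identityˡ _ ⟩
    1# * f n                          ≈⟨ *-identityˡ _ ⟩
    f n                               ∎

  commutativeSemiring : CommutativeSemiring 0ℓ 0ℓ
  commutativeSemiring = record
    { Carrier = ℕ → Carrier
    ; _≈_ = _≋_
    ; _+_ = _∔_
    ; _*_ = _✶_
    ; 0# = λ _ → 0#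
    ; 1# = const 1#
    ; isCommutativeSemiring = isCommutativeSemiringˡ record
      { +-isCommutativeMonoid = record
        { isMonoid = record
          { isSemigroup = record
            { isMagma = record
              { isEquivalence = ≋-isEquivalence
              ; ∙-cong = λ p q n → +-cong (p n) (q n) }
            ; assoc = λ f g h n → +-assoc _ _ _ }
          ; identity = (λ f n → +-identityˡ _) , (λ f n → +-identityʳ _) }
        ; comm = λ f g n → +-comm _ _ }
      ; *-isCommutativeMonoid = record
        { isMonoid = record
          { isSemigroup = record
            { isMagma = record
              { isEquivalence = ≋-isEquivalence
              ; ∙-cong = ✶-cong }
            ; assoc = ✶-assoc }
          ; identity = ✶-identityˡ , λ f n → trans (✶-comm f _ n) (✶-identityˡ f n) }
        ; comm = ✶-comm }
      ; distribʳ = ✶-distribʳ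
      ; zeroˡ = ✶-zeroˡ
      }
    }
    where
    ≋-isEquivalence : IsEquivalence _≋_
    ≋-isEquivalence = record
      { refl = λ n → refl ; sym = λ p n → sym (p n) ; trans = λ p q n → trans (p n) (q n) }

    ✶-identityˡ : ∀ f → const 1# ✶ f ≋ f
    ✶-identityˡ f n = trans (const-✶ 1# f n) (*-identityˡ _)

  -- A product at n sees only coefficients up to n, which is all that an induction on coefficients
  -- can supply.
  ✶-cong-≤ : ∀ {f f′ g g′} n → (∀ i → i ≤ n → f i ≈ f′ i) → (∀ i → i ≤ n → g i ≈ g′ i) →
             (f ✶ g) n ≈ (f′ ✶ g′) n
  ✶-cong-≤ zero    p q = *-cong (p 0 z≤n) (q 0 z≤n)
  ✶-cong-≤ (suc n) p q = +-cong (*-cong (p 0 z≤n) (q (suc n) ≤-refl))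
    (✶-cong-≤ n (λ i i≤n → p (suc i) (s≤s i≤n)) (λ i i≤n → q i (m≤n⇒m≤1+n i≤n)))

  -- The factor `X` shifts by one, so each coefficient of a solution is fixed by `h`, `g` and
  -- earlier coefficients. This stands in for multiplication by the inverse of 1 - x g.
  fixpoint-unique : ∀ g {h f f′} → f ≋ h ∔ X ✶ (g ✶ f) → f′ ≋ h ∔ X ✶ (g ✶ f′) → f ≋ f′
  fixpoint-unique g {h} {f} {f′} e e′ n = go n n ≤-refl
    where
    -- The bound m makes the induction strong: coefficient i + 1 needs every coefficient up to i.
    go : ∀ m i → i ≤ m → f i ≈ f′ i
    go m zero _ = begin
      f 0                    ≈⟨ e 0 ⟩
      h 0 + (X ✶ (g ✶ f)) 0  ≈⟨ +-congˡ (trans (X-✶-zero (g ✶ f)) (sym (X-✶-zero (g ✶ f′)))) ⟩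
      h 0 + (X ✶ (g ✶ f′)) 0 ≈⟨ e′ 0 ⟨
      f′ 0                   ∎
    go (suc m) (suc i) (s≤s i≤m) = begin
      f (suc i)                          ≈⟨ e (suc i) ⟩
      h (suc i) + (X ✶ (g ✶ f)) (suc i)  ≈⟨ +-congˡ (X-✶-suc (g ✶ f) i) ⟩
      h (suc i) + (g ✶ f) i              ≈⟨ +-congˡ (✶-cong-≤ i (λ _ _ → refl)
                                              (λ j j≤i → go m j (≤-trans j≤i i≤m))) ⟩
      h (suc i) + (g ✶ f′) i             ≈⟨ +-congˡ (X-✶-suc (g ✶ f′) i) ⟨
      h (suc i) + (X ✶ (g ✶ f′)) (suc i) ≈⟨ e′ (suc i) ⟨
      f′ (suc i)                         ∎

-- The solutions of the two linear equations are Q = x N M and P = K (x + Q).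
module Elimination (R : CommutativeSemiring 0ℓ 0ℓ) where
  open CommutativeSemiring R
  open Solver R
  open SetoidReasoning setoid

  eliminate : ∀ x y N K M P Q →
    (∀ g h {f f′} → f ≈ h + x * (g * f) → f′ ≈ h + x * (g * f′) → f ≈ f′) →
    N ≈ 1# + K → K ≈ x * ((y + K) * N) →
    M ≈ x + P + Q → Q ≈ x * M + x * ((y + K) * Q) →
    P ≈ x * (y * x + P + y * Q) + x * ((y + K) * P) →
    M ≈ x * N + x * (N * N) * M
  eliminate x y N K M P Q unique N≈1+K K-eq M-eq Q-eq P-eq = begin
    M                       ≈⟨ M≈N[x+Q] ⟩
    N * (x + Q)             ≈⟨ *-congˡ (+-congˡ Q≈xNM) ⟩
    N * (x + x * N * M)     ≈⟨ solve 3 (λ x N M → N :* (x :+ x :* N :* M) := x :* N :+ x :* (N :* N) :* M) refl x N M ⟩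
    x * N + x * (N * N) * M ∎
    where
    G = y + K
    N-solves : ∀ h → N * h ≈ h + x * (G * (N * h))
    N-solves h = begin
      N * h                    ≈⟨ *-congʳ (trans N≈1+K (+-congˡ K-eq)) ⟩
      (1# + x * (G * N)) * h   ≈⟨ solve 4 (λ x G N h → (con 1 :+ x :* (G :* N)) :* h := h :+ x :* (G :* (N :* h))) refl x G N h ⟩
      h + x * (G * (N * h))    ∎

    Q≈xNM : Q ≈ x * N * M
    Q≈xNM = trans (unique _ _ Q-eq (N-solves (x * M)))
      (solve 3 (λ x N M → N :* (x :* M) := x :* N :* M) refl x N M)

    -- Solving with the factor G still leaves P on the right, because the source term contains x P.
    -- What remains is a second linear equation, now with factor N, which K (x + Q) is then shown to
    -- satisfy as well.
    P-solves : P ≈ N * (x * (y * x + y * Q)) + x * (N * P)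
    P-solves = begin
      P
        ≈⟨ unique _ _ P-eq (N-solves _) ⟩
      N * (x * (y * x + P + y * Q))
        ≈⟨ solve 5 (λ x y N P Q → N :* (x :* (y :* x :+ P :+ y :* Q)) :=
             N :* (x :* (y :* x :+ y :* Q)) :+ x :* (N :* P)) refl x y N P Q ⟩
      N * (x * (y * x + y * Q)) + x * (N * P) ∎

    KT-solves : K * (x + Q) ≈ N * (x * (y * x + y * Q)) + x * (N * (K * (x + Q)))
    KT-solves = begin
      K * (x + Q)
        ≈⟨ *-congʳ K-eq ⟩
      x * ((y + K) * N) * (x + Q)
        ≈⟨ solve 5 (λ x y N K Q → x :* ((y :+ K) :* N) :* (x :+ Q) :=
             N :* (x :* (y :* x :+ y :* Q)) :+ x :* (N :* (K :* (x :+ Q)))) refl x y N K Q ⟩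
      N * (x * (y * x + y * Q)) + x * (N * (K * (x + Q))) ∎

    M≈N[x+Q] : M ≈ N * (x + Q)
    M≈N[x+Q] = begin
      M                     ≈⟨ M-eq ⟩
      x + P + Q             ≈⟨ +-congʳ (+-congˡ (unique _ _ P-solves KT-solves)) ⟩
      x + K * (x + Q) + Q   ≈⟨ solve 3 (λ x K Q → x :+ K :* (x :+ Q) :+ Q := (con 1 :+ K) :* (x :+ Q)) refl x K Q ⟩
      (1# + K) * (x + Q)    ≈⟨ *-congʳ N≈1+K ⟨
      N * (x + Q)           ∎

open Defs using (_≈_)
open Algebra.Properties.CommutativeSemigroup Natₚ.+-commutativeSemigroup using (interchange; x∙yz≈y∙xz)
open Nat using (_+_; _*_)
open Natₚ using (+-assoc; +-comm; +-suc; +-identityʳ; +-cancelˡ-≤; +-monoˡ-≤; +-monoʳ-≤)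
open ≡ using (refl; sym; trans)

-- Two-variable series and the product of the statement

sumTo-suc : ∀ n f → sumTo (suc n) f ≡ f 0 + sumTo n (λ i → f (suc i))
sumTo-suc zero    f = refl
sumTo-suc (suc n) f = trans (cong (_+ f (2 + n)) (sumTo-suc n f)) (+-assoc (f 0) _ _)

sumTo-cong : ∀ n {f g} → (∀ i → f i ≡ g i) → sumTo n f ≡ sumTo n g
sumTo-cong zero    p = p 0
sumTo-cong (suc n) p = cong₂ _+_ (sumTo-cong n p) (p (suc n))

-- Series in y over the naturals, then series in x over those. The carrier of `S₂` is `Series` by
-- definition, so the semiring laws apply directly to `M` and `N`.
module S₁ = PowerSeries +-*-commutativeSemiring
module S₂ = PowerSeries S₁.commutativeSemiring

open CommutativeSemiring S₁.commutativeSemiring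
  using () renaming (distribˡ to ✶₁-distribˡ; zeroʳ to ✶₁-zeroʳ)

✶₁≡sumTo : ∀ f g n → (f S₁.✶ g) n ≡ sumTo n (λ i → f i * g (n ∸ i))
✶₁≡sumTo f g zero    = refl
✶₁≡sumTo f g (suc n) = trans (cong (f 0 * g (suc n) +_) (✶₁≡sumTo _ g n))
  (sym (sumTo-suc n (λ i → f i * g (suc n ∸ i))))

✶₂≡sumTo : ∀ f g n k → (f S₂.✶ g) n k ≡ sumTo n (λ i → (f i S₁.✶ g (n ∸ i)) k)
✶₂≡sumTo f g zero    k = refl
✶₂≡sumTo f g (suc n) k = trans (cong ((f 0 S₁.✶ g (suc n)) k +_) (✶₂≡sumTo _ g n k))
  (sym (sumTo-suc n (λ i → (f i S₁.✶ g (suc n ∸ i)) k)))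

✶₂≡⊛ : ∀ f g n k → (f S₂.✶ g) n k ≡ (f ⊛ g) n k
✶₂≡⊛ f g n k = trans (✶₂≡sumTo f g n k)
  (sumTo-cong n λ i → ✶₁≡sumTo (f i) (g (n ∸ i)) k)

X-✶₂≡X· : ∀ f n k → (S₂.X S₂.✶ f) n k ≡ X· f n k
X-✶₂≡X· f zero    k = S₂.X-✶-zero f k
X-✶₂≡X· f (suc n) k = S₂.X-✶-suc f n k

-- Generating functions of lists

private variable
  A B C E : Set

count-++ : ∀ (p : A → Bool) xs ys → count p (xs ++ ys) ≡ count p xs + count p ys
count-++ p []       ys = refl
count-++ p (x ∷ xs) ys = trans (cong (_ +_) (count-++ p xs ys)) (sym (+-assoc (if p x then 1 else 0) _ _))

count-↭ : ∀ (p : A → Bool) {xs ys} → xs ↭ ys → count p xs ≡ count p ys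
count-↭ p ↭.refl           = refl
count-↭ p (↭.prep x r)     = cong (_ +_) (count-↭ p r)
count-↭ p (↭.swap x y r)   =
  trans (cong (λ c → (if p x then 1 else 0) + ((if p y then 1 else 0) + c)) (count-↭ p r))
        (x∙yz≈y∙xz (if p x then 1 else 0) (if p y then 1 else 0) _)
count-↭ p (↭.trans r r′)   = trans (count-↭ p r) (count-↭ p r′)

-- Duplicate-free lists with the same members are permutations of each other. Every decomposition
-- below is counted this way, so it takes membership in both directions and uniqueness, but no
-- explicit inverse.
count-≐ : ∀ (p : A → Bool) {xs ys} → Unique xs → Unique ys →
          (∀ {x} → x ∈ xs → x ∈ ys) → (∀ {x} → x ∈ ys → x ∈ xs) → count p xs ≡ count p ys
count-≐ p u v f g = count-↭ p (∼bag⇒↭ (unique∧set⇒bag u v (mk⇔ f g)))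

gf : (A → ℕ) → List A → ℕ → ℕ
gf st xs k = count (λ a → st a ≡ᵇ k) xs

-- The monomial y^u; `gf st xs` is a sum of these.
mono : ℕ → ℕ → ℕ
mono u k = if u ≡ᵇ k then 1 else 0

gf-++ : ∀ (st : A → ℕ) xs ys → gf st (xs ++ ys) S₁.≋ gf st xs S₁.∔ gf st ys
gf-++ st xs ys k = count-++ _ xs ys

gf-cong : ∀ (st st′ : A → ℕ) xs → (∀ {a} → a ∈ xs → st a ≡ st′ a) → gf st xs S₁.≋ gf st′ xs
gf-cong st st′ []       p k = refl
gf-cong st st′ (x ∷ xs) p k = cong₂ _+_ (cong (λ u → mono u k) (p (here refl))) (gf-cong st st′ xs (p ∘ there) k)

gf-map : ∀ (st : B → ℕ) (h : A → B) xs → gf st (map h xs) S₁.≋ gf (st ∘ h) xs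
gf-map st h []       k = refl
gf-map st h (x ∷ xs) k = cong (_ +_) (gf-map st h xs k)

mono-0 : mono 0 S₁.≋ S₁.const 1
mono-0 zero    = refl
mono-0 (suc k) = refl

mono-✶ : ∀ u v → mono u S₁.✶ mono v S₁.≋ mono (u + v)
mono-✶ zero    v k       = trans (S₁.✶-cong {g = mono v} mono-0 (λ _ → refl) k)
                                 (trans (S₁.const-✶ 1 (mono v) k) (+-identityʳ _))
mono-✶ (suc u) v zero    = refl
mono-✶ (suc u) v (suc k) = mono-✶ u v k

gf-suc : ∀ (st : A → ℕ) xs → gf (suc ∘ st) xs S₁.≋ mono 1 S₁.✶ gf st xs
gf-suc st []       k = sym (trans (S₁.✶-comm (mono 1) _ k) (S₁.✶-zeroˡ (mono 1) k))
gf-suc st (x ∷ xs) k = begin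
  mono (suc (st x)) k + gf (suc ∘ st) xs k
    ≡⟨ cong₂ _+_ (sym (mono-✶ 1 (st x) k)) (gf-suc st xs k) ⟩
  (mono 1 S₁.✶ mono (st x)) k + (mono 1 S₁.✶ gf st xs) k
    ≡⟨ ✶₁-distribˡ (mono 1) (mono (st x)) (gf st xs) k ⟨
  (mono 1 S₁.✶ gf st (x ∷ xs)) k ∎
  where
  open ≡.≡-Reasoning

gf-cartesianProductWith :
  ∀ (st : C → ℕ) (st₁ : A → ℕ) (st₂ : B → ℕ) (h : A → B → C) xs ys →
  (∀ {a b} → a ∈ xs → b ∈ ys → st (h a b) ≡ st₁ a + st₂ b) →
  gf st (cartesianProductWith h xs ys) S₁.≋ gf st₁ xs S₁.✶ gf st₂ ys
gf-cartesianProductWith st st₁ st₂ h []       ys p k = sym (S₁.✶-zeroˡ (gf st₂ ys) k)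
gf-cartesianProductWith st st₁ st₂ h (x ∷ xs) ys p k = begin
  gf st (map (h x) ys ++ cartesianProductWith h xs ys) k
    ≡⟨ gf-++ st (map (h x) ys) _ k ⟩
  gf st (map (h x) ys) k + gf st (cartesianProductWith h xs ys) k
    ≡⟨ cong₂ _+_ (row ys (p (here refl))) (gf-cartesianProductWith st st₁ st₂ h xs ys (p ∘ there) k) ⟩
  (mono (st₁ x) S₁.✶ gf st₂ ys) k + (gf st₁ xs S₁.✶ gf st₂ ys) k
    ≡⟨ S₁.✶-distribʳ (gf st₂ ys) (mono (st₁ x)) (gf st₁ xs) k ⟨
  (gf st₁ (x ∷ xs) S₁.✶ gf st₂ ys) k ∎
  where
  open ≡.≡-Reasoning
  row : ∀ ys → (∀ {b} → b ∈ ys → st (h x b) ≡ st₁ x + st₂ b) →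
        gf st (map (h x) ys) k ≡ (mono (st₁ x) S₁.✶ gf st₂ ys) k
  row []       q = sym (✶₁-zeroʳ (mono (st₁ x)) k)
  row (y ∷ ys) q = begin
    mono (st (h x y)) k + gf st (map (h x) ys) k
      ≡⟨ cong₂ _+_ (trans (cong (λ u → mono u k) (q (here refl))) (sym (mono-✶ (st₁ x) (st₂ y) k)))
                   (row ys (q ∘ there)) ⟩
    (mono (st₁ x) S₁.✶ mono (st₂ y)) k + (mono (st₁ x) S₁.✶ gf st₂ ys) k
      ≡⟨ ✶₁-distribˡ (mono (st₁ x)) (mono (st₂ y)) (gf st₂ ys) k ⟨
    (mono (st₁ x) S₁.✶ gf st₂ (y ∷ ys)) k ∎

unique-map : ∀ (h : A → B) {xs} → (∀ {a a′} → a ∈ xs → a′ ∈ xs → h a ≡ h a′ → a ≡ a′) →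
             Unique xs → Unique (map h xs)
unique-map h inj []       = []
unique-map h inj (x∉ ∷ u) =
  All.tabulate (λ z∈ eq → let a , a∈ , z≡ = ∈-map⁻ h z∈ in
    All.lookup x∉ a∈ (inj (here refl) (there a∈) (trans eq z≡)))
  ∷ unique-map h (λ p q → inj (there p) (there q)) u

-- Injectivity is asked of members only: an arch or a word cut at its minimum determines its factors
-- only under the Dyck condition or the bounds on the letters.
unique-cartesianProductWith :
  ∀ (h : A → B → C) {xs ys} →
  (∀ {a a′ b b′} → a ∈ xs → b ∈ ys → a′ ∈ xs → b′ ∈ ys → h a b ≡ h a′ b′ → a ≡ a′ × b ≡ b′) →
  Unique xs → Unique ys → Unique (cartesianProductWith h xs ys)
unique-cartesianProductWith h inj []       v = []
unique-cartesianProductWith h {x ∷ xs} {ys} inj (x∉ ∷ u) v = Unique.++⁺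
  (unique-map (h x) (λ b∈ b′∈ eq → let _ , e = inj (here refl) b∈ (here refl) b′∈ eq in e) v)
  (unique-cartesianProductWith h (λ a∈ b∈ a′∈ b′∈ → inj (there a∈) b∈ (there a′∈) b′∈) u v)
  λ (z∈ , z∈′) →
    let b , b∈ , z≡ = ∈-map⁻ (h x) z∈
        a′ , b′ , a′∈ , b′∈ , z≡′ = ∈-cartesianProductWith⁻ h xs ys z∈′
        x≡a′ , _ = inj (here refl) b∈ (there a′∈) b′∈ (trans (sym z≡) z≡′)
    in All.lookup x∉ a′∈ x≡a′

module _ {A B C : Set} (h : A → B → C) where

  -- The counterpart of `_✶_` for lists. The right family also receives the size i of the left
  -- factor, because the interval used by a right block starts where that of the left block ends.
  product : (ℕ → List A) → (ℕ → ℕ → List B) → ℕ → List C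
  product P Q zero    = cartesianProductWith h (P 0) (Q 0 0)
  product P Q (suc n) =
    cartesianProductWith h (P 0) (Q 0 (suc n)) ++ product (P ∘ suc) (Q ∘ suc) n

  ∈-product⁺ : ∀ {P Q} i j {a b} → a ∈ P i → b ∈ Q i j → h a b ∈ product P Q (i + j)
  ∈-product⁺ zero    zero    a∈ b∈ = ∈-cartesianProductWith⁺ h a∈ b∈
  ∈-product⁺ zero    (suc j) a∈ b∈ = ∈-++⁺ˡ (∈-cartesianProductWith⁺ h a∈ b∈)
  ∈-product⁺ (suc i) j       a∈ b∈ = ∈-++⁺ʳ _ (∈-product⁺ i j a∈ b∈)

  ∈-product⁻ : ∀ P Q n {c} → c ∈ product P Q n →
               ∃[ i ] ∃[ j ] ∃[ a ] ∃[ b ] (i + j ≡ n × a ∈ P i × b ∈ Q i j × c ≡ h a b)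
  ∈-product⁻ P Q zero c∈ =
    let a , b , a∈ , b∈ , eq = ∈-cartesianProductWith⁻ h (P 0) (Q 0 0) c∈
    in 0 , 0 , a , b , refl , a∈ , b∈ , eq
  ∈-product⁻ P Q (suc n) c∈ with ∈-++⁻ (cartesianProductWith h (P 0) (Q 0 (suc n))) c∈
  ... | inj₁ c∈₁ =
    let a , b , a∈ , b∈ , eq = ∈-cartesianProductWith⁻ h (P 0) (Q 0 (suc n)) c∈₁
    in 0 , suc n , a , b , refl , a∈ , b∈ , eq
  ... | inj₂ c∈₂ =
    let i , j , a , b , i+j≡n , rest = ∈-product⁻ (P ∘ suc) (Q ∘ suc) n c∈₂
    in suc i , j , a , b , cong suc i+j≡n , rest

  unique-product :
    ∀ {P Q} n →
    (∀ {i j i′ j′ a b a′ b′} → a ∈ P i → b ∈ Q i j → a′ ∈ P i′ → b′ ∈ Q i′ j′ →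
      h a b ≡ h a′ b′ → i ≡ i′ × a ≡ a′ × b ≡ b′) →
    (∀ i → Unique (P i)) → (∀ i j → Unique (Q i j)) → Unique (product P Q n)
  unique-product zero inj u v = unique-cartesianProductWith h
    (λ a∈ b∈ a′∈ b′∈ eq → let _ , e = inj a∈ b∈ a′∈ b′∈ eq in e) (u 0) (v 0 0)
  unique-product {P} {Q} (suc n) inj u v = Unique.++⁺
    (unique-cartesianProductWith h
      (λ a∈ b∈ a′∈ b′∈ eq → let _ , e = inj a∈ b∈ a′∈ b′∈ eq in e) (u 0) (v 0 (suc n)))
    (unique-product n
      (λ a∈ b∈ a′∈ b′∈ eq → let i≡ , e = inj a∈ b∈ a′∈ b′∈ eq in suc-injective i≡ , e)
      (u ∘ suc) (v ∘ suc))
    λ (z∈ , z∈′) →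
      let a , b , a∈ , b∈ , z≡ = ∈-cartesianProductWith⁻ h (P 0) (Q 0 (suc n)) z∈
          i , j , a′ , b′ , _ , a′∈ , b′∈ , z≡′ = ∈-product⁻ (P ∘ suc) (Q ∘ suc) n z∈′
          0≡1+i , _ = inj a∈ b∈ a′∈ b′∈ (trans (sym z≡) z≡′)
      in 0≢1+n 0≡1+i

  -- The counts of `Q i j` have to depend on j alone, which for blocks of permutations is invariance
  -- under translation. The bounds by n allow use inside a strong induction on size.
  gf-product :
    ∀ (st : C → ℕ) (st₁ : A → ℕ) (st₂ : B → ℕ) {P Q f g} n →
    (∀ {i j a b} → a ∈ P i → b ∈ Q i j → st (h a b) ≡ st₁ a + st₂ b) →
    (∀ i → i ≤ n → gf st₁ (P i) S₁.≋ f i) → (∀ i j → j ≤ n → gf st₂ (Q i j) S₁.≋ g j) →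
    gf st (product P Q n) S₁.≋ (f S₂.✶ g) n
  gf-product st st₁ st₂ {P} {Q} {f} {g} zero w p q k = trans
    (gf-cartesianProductWith st st₁ st₂ h (P 0) (Q 0 0) w k)
    (S₁.✶-cong (p 0 z≤n) (q 0 0 z≤n) k)
  gf-product st st₁ st₂ {P} {Q} {f} {g} (suc n) w p q k = trans
    (gf-++ st (cartesianProductWith h (P 0) (Q 0 (suc n))) _ k)
    (cong₂ _+_
      (trans (gf-cartesianProductWith st st₁ st₂ h (P 0) (Q 0 (suc n)) w k)
             (S₁.✶-cong (p 0 z≤n) (q 0 (suc n) ≤-refl) k))
      (gf-product st st₁ st₂ n w (λ i i≤n → p (suc i) (s≤s i≤n)) (λ i j j≤n → q (suc i) j (m≤n⇒m≤1+n j≤n)) k))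

-- Dyck paths

∈-allSteps⁺ : ∀ p → p ∈ allSteps (length p)
∈-allSteps⁺ []      = here refl
∈-allSteps⁺ (U ∷ p) = ∈-concatMap⁺ _ (lose (∈-allSteps⁺ p) (here refl))
∈-allSteps⁺ (D ∷ p) = ∈-concatMap⁺ _ (lose (∈-allSteps⁺ p) (there (here refl)))

∈-allSteps⁻ : ∀ n {p} → p ∈ allSteps n → length p ≡ n
∈-allSteps⁻ zero    (here refl) = refl
∈-allSteps⁻ (suc n) p∈ with find (∈-concatMap⁻ _ {xs = allSteps n} p∈)
... | w , w∈ , here refl         = cong suc (∈-allSteps⁻ n w∈)
... | w , w∈ , there (here refl) = cong suc (∈-allSteps⁻ n w∈)

allSteps-unique : ∀ n → Unique (allSteps n)
allSteps-unique zero    = [] ∷ []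
allSteps-unique (suc n) = extend (allSteps-unique n)
  where
  steps : List Step → List (List Step)
  steps w = (U ∷ w) ∷ (D ∷ w) ∷ []

  tail∈ : ∀ ws {s p} → s ∷ p ∈ concatMap steps ws → p ∈ ws
  tail∈ ws p∈ with find (∈-concatMap⁻ steps {xs = ws} p∈)
  ... | w , w∈ , here refl         = w∈
  ... | w , w∈ , there (here refl) = w∈

  extend : ∀ {ws} → Unique ws → Unique (concatMap steps ws)
  extend []               = []
  extend {w ∷ ws} (w∉ ∷ u) =
    ((λ ()) ∷ fresh) ∷ fresh ∷ extend u
    where
    fresh : ∀ {s} → All (s ∷ w ≢_) (concatMap steps ws)
    fresh = All.tabulate λ p∈ eq → All.lookup w∉ (tail∈ ws (subst (_∈ concatMap steps ws) (sym eq) p∈)) refl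

∈-dyckPaths⁺ : ∀ n {p} → length p ≡ n + n → dyckFrom 0 p ≡ true → p ∈ dyckPaths n
∈-dyckPaths⁺ n {p} len d = ∈-filter⁺ (λ p → isDyck p ≟ᵇ true)
  (subst (λ m → p ∈ allSteps m) len (∈-allSteps⁺ p)) d

∈-dyckPaths⁻ : ∀ n {p} → p ∈ dyckPaths n → length p ≡ n + n × dyckFrom 0 p ≡ true
∈-dyckPaths⁻ n p∈ =
  let p∈′ , d = ∈-filter⁻ (λ p → isDyck p ≟ᵇ true) p∈ in ∈-allSteps⁻ (n + n) p∈′ , d

dyckPaths-unique : ∀ n → Unique (dyckPaths n)
dyckPaths-unique n = Unique.filter⁺ (λ p → isDyck p ≟ᵇ true) (allSteps-unique (n + n))

arch : List Step → List Step → List Step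
arch A B = U ∷ A ++ D ∷ B

-- Splits at the first return to height h.
dyckFrom-split : ∀ j h p → dyckFrom (suc (j + h)) p ≡ true →
  ∃[ A ] ∃[ B ] (p ≡ A ++ D ∷ B × dyckFrom j A ≡ true × dyckFrom h B ≡ true)
dyckFrom-split j h (U ∷ p) d =
  let A , B , p≡ , dA , dB = dyckFrom-split (suc j) h p d in U ∷ A , B , cong (U ∷_) p≡ , up j A dA , dB
  where
  up : ∀ j A → dyckFrom (suc j) A ≡ true → dyckFrom j (U ∷ A) ≡ true
  up zero    A d = d
  up (suc j) A d = d
dyckFrom-split zero    h (D ∷ p) d = [] , p , refl , refl , d
dyckFrom-split (suc j) h (D ∷ p) d =
  let A , B , p≡ , dA , dB = dyckFrom-split j h p d in D ∷ A , B , cong (D ∷_) p≡ , dA , dB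

dyckFrom-join : ∀ j h A B → dyckFrom j A ≡ true → dyckFrom h B ≡ true →
                dyckFrom (suc (j + h)) (A ++ D ∷ B) ≡ true
dyckFrom-join zero    h []      B dA dB = dB
dyckFrom-join zero    h (U ∷ A) B dA dB = dyckFrom-join 1 h A B dA dB
dyckFrom-join (suc j) h (U ∷ A) B dA dB = dyckFrom-join (suc (suc j)) h A B dA dB
dyckFrom-join (suc j) h (D ∷ A) B dA dB = dyckFrom-join j h A B dA dB

-- The D after a path that ends at height zero is the first step below zero, so both factorisations
-- place it at the same position.
dyckFrom-cancel : ∀ j A A′ {B B′} → dyckFrom j A ≡ true → dyckFrom j A′ ≡ true →
                  A ++ D ∷ B ≡ A′ ++ D ∷ B′ → A ≡ A′ × B ≡ B′
dyckFrom-cancel zero    []      []       d d′ refl = refl , refl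
dyckFrom-cancel zero    []      (D ∷ A′) d () eq
dyckFrom-cancel zero    (D ∷ A) []       () d′ eq
dyckFrom-cancel zero    (U ∷ A) (U ∷ A′) d d′ eq =
  let A≡ , B≡ = dyckFrom-cancel 1 A A′ d d′ (∷-injectiveʳ eq) in cong (U ∷_) A≡ , B≡
dyckFrom-cancel (suc j) (U ∷ A) (U ∷ A′) d d′ eq =
  let A≡ , B≡ = dyckFrom-cancel (suc (suc j)) A A′ d d′ (∷-injectiveʳ eq) in cong (U ∷_) A≡ , B≡
dyckFrom-cancel (suc j) (D ∷ A) (D ∷ A′) d d′ eq =
  let A≡ , B≡ = dyckFrom-cancel j A A′ d d′ (∷-injectiveʳ eq) in cong (D ∷_) A≡ , B≡

-- Each step changes the parity of the height. This supplies the semilengths of the two factors of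
-- an arch.
dyckFrom-even : ∀ j A → dyckFrom j A ≡ true → ∃[ i ] (length A + j ≡ i + i)
dyckFrom-even zero    []      d = 0 , refl
dyckFrom-even zero    (U ∷ A) d =
  let i , eq = dyckFrom-even 1 A d in i , trans (sym (+-suc (length A) 0)) eq
dyckFrom-even (suc j) (U ∷ A) d =
  let i , eq = dyckFrom-even (suc (suc j)) A d in i , trans (sym (+-suc (length A) (suc j))) eq
dyckFrom-even (suc j) (D ∷ A) d =
  let i , eq = dyckFrom-even j A d in
  suc i , cong suc (trans (+-suc (length A) j) (trans (cong suc eq) (sym (+-suc i i))))

length-arch : ∀ A B → length (arch A B) ≡ 2 + (length A + length B)
length-arch A B = cong suc (trans (length-++ A) (+-suc (length A) (length B)))

double-injective : ∀ m n → m + m ≡ n + n → m ≡ n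
double-injective zero    zero    eq = refl
double-injective (suc m) (suc n) eq = cong suc (double-injective m n
  (suc-injective (trans (sym (+-suc m m)) (trans (suc-injective eq) (+-suc n n)))))

+-double : ∀ i j → (i + j) + (i + j) ≡ (i + i) + (j + j)
+-double i j = interchange i j i j

dyck⇒arch : ∀ n {p} → length p ≡ suc n + suc n → dyckFrom 0 p ≡ true →
  ∃[ i ] ∃[ j ] ∃[ A ] ∃[ B ] (i + j ≡ n × A ∈ dyckPaths i × B ∈ dyckPaths j × p ≡ arch A B)
dyck⇒arch n {U ∷ p} len d
  with A , B , refl , dA , dB ← dyckFrom-split 0 0 p d
  with i , lenA ← dyckFrom-even 0 A dA | j , lenB ← dyckFrom-even 0 B dB
  = i , j , A , B , double-injective (i + j) n i+j≡n
  , ∈-dyckPaths⁺ i lenA′ dA , ∈-dyckPaths⁺ j lenB′ dB , refl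
  where
  lenA′ = trans (sym (+-identityʳ _)) lenA
  lenB′ = trans (sym (+-identityʳ _)) lenB
  i+j≡n : (i + j) + (i + j) ≡ n + n
  i+j≡n = suc-injective (suc-injective (begin
    2 + ((i + j) + (i + j))   ≡⟨ cong (2 +_) (+-double i j) ⟩
    2 + ((i + i) + (j + j))   ≡⟨ cong (2 +_) (cong₂ _+_ lenA′ lenB′) ⟨
    2 + (length A + length B) ≡⟨ length-arch A B ⟨
    length (arch A B)         ≡⟨ len ⟩
    suc n + suc n             ≡⟨ cong suc (+-suc n n) ⟩
    2 + (n + n)               ∎))
    where open ≡.≡-Reasoning

arch∈ : ∀ i j {A B} → A ∈ dyckPaths i → B ∈ dyckPaths j → arch A B ∈ dyckPaths (suc (i + j))
arch∈ i j {A} {B} A∈ B∈ =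
  let lenA , dA = ∈-dyckPaths⁻ i A∈
      lenB , dB = ∈-dyckPaths⁻ j B∈
  in ∈-dyckPaths⁺ (suc (i + j)) (begin
    length (arch A B)         ≡⟨ length-arch A B ⟩
    2 + (length A + length B) ≡⟨ cong (2 +_) (cong₂ _+_ lenA lenB) ⟩
    2 + ((i + i) + (j + j))   ≡⟨ cong (2 +_) (+-double i j) ⟨
    2 + ((i + j) + (i + j))   ≡⟨ cong suc (+-suc (i + j) (i + j)) ⟨
    suc (i + j) + suc (i + j) ∎) (dyckFrom-join 0 0 A B dA dB)
  where open ≡.≡-Reasoning

arch-injective : ∀ {i j i′ j′ A B A′ B′} →
  A ∈ dyckPaths i → B ∈ dyckPaths j → A′ ∈ dyckPaths i′ → B′ ∈ dyckPaths j′ →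
  arch A B ≡ arch A′ B′ → i ≡ i′ × A ≡ A′ × B ≡ B′
arch-injective {i} {i′ = i′} {A = A} {A′ = A′} A∈ B∈ A′∈ B′∈ eq =
  let lenA , dA = ∈-dyckPaths⁻ i A∈
      lenA′ , dA′ = ∈-dyckPaths⁻ i′ A′∈
      A≡A′ , B≡B′ = dyckFrom-cancel 0 A A′ dA dA′ (∷-injectiveʳ eq)
  in double-injective i i′ (trans (sym lenA) (trans (cong length A≡A′) lenA′)) , A≡A′ , B≡B′

-- The peaks of U ∷ p ++ D ∷ [].
peak⁺ : List Step → ℕ
peak⁺ []        = 1
peak⁺ p@(_ ∷ _) = peak p

-- A nonempty path that ends at height zero ends with D, so the separating D closes no new peak.
peak-join : ∀ j x A B → dyckFrom j (x ∷ A) ≡ true → peak (x ∷ A ++ D ∷ B) ≡ peak (x ∷ A) + peak B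
peak-join zero    U []      B ()
peak-join (suc j) U []      B ()
peak-join zero    U (U ∷ A) B d = peak-join 1 U A B d
peak-join (suc j) U (U ∷ A) B d = peak-join (suc (suc j)) U A B d
peak-join zero    U (D ∷ A) B d = cong suc (peak-join 1 D A B d)
peak-join (suc j) U (D ∷ A) B d = cong suc (peak-join (suc (suc j)) D A B d)
peak-join (suc j) D []      B d = refl
peak-join (suc j) D (y ∷ A) B d = peak-join j y A B d

peak-arch : ∀ A B → dyckFrom 0 A ≡ true → peak (arch A B) ≡ peak⁺ A + peak B
peak-arch []      B d = refl
peak-arch (U ∷ A) B d = peak-join 0 U A B d

-- The series y + K of the overview: `peak⁺` gives the empty path the weight y.
N⁺ : ℕ → ℕ → ℕ
N⁺ n = gf peak⁺ (dyckPaths n)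

N⁺-suc : ∀ n → N⁺ (suc n) S₁.≋ N (suc n)
N⁺-suc n = gf-cong peak⁺ peak (dyckPaths (suc n)) λ {p} p∈ → nonempty p (proj₁ (∈-dyckPaths⁻ (suc n) p∈))
  where
  nonempty : ∀ p → length p ≡ suc n + suc n → peak⁺ p ≡ peak p
  nonempty (_ ∷ _) _ = refl

N-recurrence : ∀ n → N (suc n) S₁.≋ (N⁺ S₂.✶ N) n
N-recurrence n k = trans
  (count-≐ _ (dyckPaths-unique (suc n))
    (unique-product arch n (λ {i} {j} {i′} {j′} → arch-injective {i} {j} {i′} {j′})
      dyckPaths-unique (λ _ → dyckPaths-unique))
    (λ p∈ → let len , d = ∈-dyckPaths⁻ (suc n) p∈
                i , j , A , B , i+j≡n , A∈ , B∈ , p≡ = dyck⇒arch n len d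
            in subst₂ (λ p n → p ∈ product arch dyckPaths (λ _ → dyckPaths) n)
                 (sym p≡) i+j≡n (∈-product⁺ arch i j A∈ B∈))
    (λ p∈ → let i , j , A , B , i+j≡n , A∈ , B∈ , p≡ = ∈-product⁻ arch dyckPaths (λ _ → dyckPaths) n p∈
            in subst₂ (λ p n → p ∈ dyckPaths (suc n)) (sym p≡) i+j≡n (arch∈ i j A∈ B∈)))
  (gf-product arch peak peak⁺ peak n
    (λ {i} {j} {A} {B} A∈ B∈ → peak-arch A B (proj₂ (∈-dyckPaths⁻ i A∈)))
    (λ i _ _ → refl) (λ i j _ _ → refl) k)

-- Pattern avoidance

<ᵇ-true : ∀ {m n} → m < n → (m <ᵇ n) ≡ true
<ᵇ-true {m} {n} m<n with m <ᵇ n | <⇒<ᵇ m<n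
... | true | _ = refl

<ᵇ-false : ∀ {m n} → n ≤ m → (m <ᵇ n) ≡ false
<ᵇ-false {m} {n} n≤m with m <ᵇ n in eq
... | true  = contradiction n≤m (<⇒≱ (<ᵇ⇒< m n (subst T (sym eq) _)))
... | false = refl

any-false⁻ : ∀ (p : E → Bool) xs → any p xs ≡ false → ∀ {x} → x ∈ xs → p x ≡ false
any-false⁻ p (x ∷ xs) eq x∈ with p x in e
any-false⁻ p (x ∷ xs) eq (here refl) | false = e
any-false⁻ p (x ∷ xs) eq (there x∈)  | false = any-false⁻ p xs eq x∈

any-false⁺ : ∀ (p : E → Bool) xs → (∀ {x} → x ∈ xs → p x ≡ false) → any p xs ≡ false
any-false⁺ p []       f = refl
any-false⁺ p (x ∷ xs) f rewrite f (here refl) = any-false⁺ p xs (f ∘ there)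

all-not⁻ : ∀ (p : E → Bool) xs → all (not ∘ p) xs ≡ true → All (λ x → p x ≡ false) xs
all-not⁻ p []       eq = []
all-not⁻ p (x ∷ xs) eq with p x in e
... | false = e ∷ all-not⁻ p xs eq

all-not⁺ : ∀ (p : E → Bool) {xs} → All (λ x → p x ≡ false) xs → all (not ∘ p) xs ≡ true
all-not⁺ p []       = refl
all-not⁺ p (e ∷ es) rewrite e = all-not⁺ p es

∈-subseqs⁺ : ∀ {s w} → s ⊆ w → s ∈ subseqs (length s) w
∈-subseqs⁺ []                      = here refl
∈-subseqs⁺ {[]}    (y ∷ʳ τ)        = here refl
∈-subseqs⁺ {_ ∷ _} (y ∷ʳ τ)        = ∈-++⁺ʳ _ (∈-subseqs⁺ τ)
∈-subseqs⁺ (refl ∷ τ)              = ∈-++⁺ˡ (∈-map⁺ _ (∈-subseqs⁺ τ))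

∈-subseqs⁻ : ∀ k w {s} → s ∈ subseqs k w → s ⊆ w × length s ≡ k
∈-subseqs⁻ zero    w       (here refl) = minimum w , refl
∈-subseqs⁻ (suc k) (a ∷ w) s∈ with ∈-++⁻ (map (a ∷_) (subseqs k w)) s∈
... | inj₁ s∈₁ with s , s∈₂ , refl ← ∈-map⁻ (a ∷_) s∈₁ =
  let τ , len = ∈-subseqs⁻ k w s∈₂ in refl ∷ τ , cong suc len
... | inj₂ s∈₁ = let τ , len = ∈-subseqs⁻ (suc k) w s∈₁ in a ∷ʳ τ , len

avoidsAll⁻ : ∀ {ts w s} → avoidsAll ts w ≡ true → s ⊆ w → All (λ t → length t ≡ length s) ts →
             All (λ t → sameOrder s t ≡ false) ts
avoidsAll⁻ {ts} {w} {s} av s⊆w lens = All.zipWith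
  (λ {t} (len , free) → any-false⁻ (λ s → sameOrder s t) _ free
    (subst (λ k → s ∈ subseqs k w) (sym len) (∈-subseqs⁺ s⊆w)))
  (lens , all-not⁻ (contains w) ts av)

avoidsAll⁺ : ∀ {ts w} k → All (λ t → length t ≡ k) ts →
             (∀ {s} → s ⊆ w → length s ≡ k → All (λ t → sameOrder s t ≡ false) ts) →
             avoidsAll ts w ≡ true
avoidsAll⁺ {ts} {w} k lens free = all-not⁺ (contains w) (All.tabulate λ {t} t∈ →
  any-false⁺ (λ s → sameOrder s t) _ λ s∈ →
    let s⊆w , len = ∈-subseqs⁻ (length t) w s∈
    in All.lookup (free s⊆w (trans len (All.lookup lens t∈))) t∈)

-- Stated positively, and with b ≤ a because `sameOrder` only tests whether a < b. The equivalence
-- with the Boolean test then holds for all words, with repeated letters or not.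
Avoids312 : List ℕ → Set
Avoids312 w = ∀ a b c → a ∷ b ∷ c ∷ [] ⊆ w → b ≤ a → b < c → a < c

-- A pattern of T₂ is a descent a b followed by two letters above b that are not both above a.
AvoidsT₂ : List ℕ → Set
AvoidsT₂ w = ∀ a b c d → a ∷ b ∷ c ∷ d ∷ [] ⊆ w → b ≤ a → b < c → b < d → a < c × a < d

⟨312⟩ : List (List ℕ)
⟨312⟩ = (3 ∷ 1 ∷ 2 ∷ []) ∷ []

-- Unless a is below both c and d, the place of a relative to c and d, and the order of c and d when
-- both are below a, select one of the four patterns: c ≤ a < d gives 3124, d ≤ a < c gives 3142,
-- and the rest 4123 or 4132.
sameOrder-T₂⁻ : ∀ a b c d → All (λ t → sameOrder (a ∷ b ∷ c ∷ d ∷ []) t ≡ false) T₂ →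
                b ≤ a → b < c → b < d → a < c × a < d
sameOrder-T₂⁻ a b c d (h₁ ∷ h₂ ∷ h₃ ∷ h₄ ∷ []) b≤a b<c b<d
  rewrite <ᵇ-false b≤a | <ᵇ-true b<c | <ᵇ-true b<d
  with <-≤-connex a c | <-≤-connex a d | <-≤-connex c d
... | inj₁ a<c | inj₁ a<d | _        = a<c , a<d
... | inj₁ a<c | inj₂ d≤a | _
  rewrite <ᵇ-true a<c | <ᵇ-false d≤a | <ᵇ-false (≤-trans d≤a (<⇒≤ a<c)) = contradiction h₂ λ ()
... | inj₂ c≤a | inj₁ a<d | _
  rewrite <ᵇ-false c≤a | <ᵇ-true a<d | <ᵇ-true (≤-<-trans c≤a a<d) = contradiction h₁ λ ()
... | inj₂ c≤a | inj₂ d≤a | inj₁ c<d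
  rewrite <ᵇ-false c≤a | <ᵇ-false d≤a | <ᵇ-true c<d = contradiction h₃ λ ()
... | inj₂ c≤a | inj₂ d≤a | inj₂ d≤c
  rewrite <ᵇ-false c≤a | <ᵇ-false d≤a | <ᵇ-false d≤c = contradiction h₄ λ ()

-- In every case all four patterns are refuted before c is compared with d, so the cases need no
-- such comparison.
sameOrder-T₂⁺ : ∀ a b c d → (b ≤ a → b < c → b < d → a < c × a < d) →
                let s = a ∷ b ∷ c ∷ d ∷ [] in
                sameOrder s (3 ∷ 1 ∷ 2 ∷ 4 ∷ []) ≡ false × sameOrder s (3 ∷ 1 ∷ 4 ∷ 2 ∷ []) ≡ false ×
                sameOrder s (4 ∷ 1 ∷ 2 ∷ 3 ∷ []) ≡ false × sameOrder s (4 ∷ 1 ∷ 3 ∷ 2 ∷ []) ≡ false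
sameOrder-T₂⁺ a b c d h
  with <-≤-connex a b | <-≤-connex a c | <-≤-connex a d | <-≤-connex b c | <-≤-connex b d
... | inj₁ a<b | _ | _ | _ | _ rewrite <ᵇ-true a<b = refl , refl , refl , refl
... | inj₂ b≤a | inj₁ a<c | inj₁ a<d | _ | _
  rewrite <ᵇ-false b≤a | <ᵇ-true a<c | <ᵇ-true a<d = refl , refl , refl , refl
... | inj₂ b≤a | inj₁ a<c | inj₂ d≤a | inj₂ c≤b | _
  rewrite <ᵇ-false b≤a | <ᵇ-true a<c | <ᵇ-false d≤a | <ᵇ-false c≤b = refl , refl , refl , refl
... | inj₂ b≤a | inj₂ c≤a | inj₁ a<d | inj₂ c≤b | _
  rewrite <ᵇ-false b≤a | <ᵇ-false c≤a | <ᵇ-true a<d | <ᵇ-false c≤b = refl , refl , refl , refl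
... | inj₂ b≤a | inj₂ c≤a | inj₂ d≤a | inj₂ c≤b | _
  rewrite <ᵇ-false b≤a | <ᵇ-false c≤a | <ᵇ-false d≤a | <ᵇ-false c≤b = refl , refl , refl , refl
... | inj₂ b≤a | inj₁ a<c | inj₂ d≤a | inj₁ b<c | inj₂ d≤b
  rewrite <ᵇ-false b≤a | <ᵇ-true a<c | <ᵇ-false d≤a | <ᵇ-true b<c | <ᵇ-false d≤b = refl , refl , refl , refl
... | inj₂ b≤a | inj₂ c≤a | inj₁ a<d | inj₁ b<c | inj₂ d≤b
  rewrite <ᵇ-false b≤a | <ᵇ-false c≤a | <ᵇ-true a<d | <ᵇ-true b<c | <ᵇ-false d≤b = refl , refl , refl , refl
... | inj₂ b≤a | inj₂ c≤a | inj₂ d≤a | inj₁ b<c | inj₂ d≤b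
  rewrite <ᵇ-false b≤a | <ᵇ-false c≤a | <ᵇ-false d≤a | <ᵇ-true b<c | <ᵇ-false d≤b = refl , refl , refl , refl
... | inj₂ b≤a | inj₂ c≤a | _        | inj₁ b<c | inj₁ b<d =
  contradiction c≤a (<⇒≱ (proj₁ (h b≤a b<c b<d)))
... | inj₂ b≤a | inj₁ a<c | inj₂ d≤a | inj₁ b<c | inj₁ b<d =
  contradiction d≤a (<⇒≱ (proj₂ (h b≤a b<c b<d)))

sameOrder-312⁻ : ∀ a b c → sameOrder (a ∷ b ∷ c ∷ []) (3 ∷ 1 ∷ 2 ∷ []) ≡ false →
                 b ≤ a → b < c → a < c
sameOrder-312⁻ a b c h b≤a b<c with <-≤-connex a c
... | inj₁ a<c = a<c
... | inj₂ c≤a rewrite <ᵇ-false b≤a | <ᵇ-true b<c | <ᵇ-false c≤a = contradiction h λ ()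

sameOrder-312⁺ : ∀ a b c → (b ≤ a → b < c → a < c) →
                 sameOrder (a ∷ b ∷ c ∷ []) (3 ∷ 1 ∷ 2 ∷ []) ≡ false
sameOrder-312⁺ a b c h with <-≤-connex a b | <-≤-connex a c | <-≤-connex b c
... | inj₁ a<b | _ | _ rewrite <ᵇ-true a<b = refl
... | inj₂ b≤a | inj₁ a<c | _ rewrite <ᵇ-false b≤a | <ᵇ-true a<c = refl
... | inj₂ b≤a | inj₂ c≤a | inj₂ c≤b rewrite <ᵇ-false b≤a | <ᵇ-false c≤a | <ᵇ-false c≤b = refl
... | inj₂ b≤a | inj₂ c≤a | inj₁ b<c = contradiction c≤a (<⇒≱ (h b≤a b<c))

avoidsT₂⁻ : ∀ {w} → avoidsAll T₂ w ≡ true → AvoidsT₂ w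
avoidsT₂⁻ av a b c d s⊆w =
  sameOrder-T₂⁻ a b c d (avoidsAll⁻ av s⊆w (refl ∷ refl ∷ refl ∷ refl ∷ []))

avoidsT₂⁺ : ∀ {w} → AvoidsT₂ w → avoidsAll T₂ w ≡ true
avoidsT₂⁺ {w} av = avoidsAll⁺ 4 (refl ∷ refl ∷ refl ∷ refl ∷ []) free
  where
  free : ∀ {s} → s ⊆ w → length s ≡ 4 → All (λ t → sameOrder s t ≡ false) T₂
  free {a ∷ b ∷ c ∷ d ∷ []} s⊆w _ =
    let h₁ , h₂ , h₃ , h₄ = sameOrder-T₂⁺ a b c d (av a b c d s⊆w) in h₁ ∷ h₂ ∷ h₃ ∷ h₄ ∷ []

avoids312⁻ : ∀ {w} → avoidsAll ⟨312⟩ w ≡ true → Avoids312 w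
avoids312⁻ av a b c s⊆w = sameOrder-312⁻ a b c (All.head (avoidsAll⁻ {⟨312⟩} av s⊆w (refl ∷ [])))

avoids312⁺ : ∀ {w} → Avoids312 w → avoidsAll ⟨312⟩ w ≡ true
avoids312⁺ {w} av = avoidsAll⁺ 3 (refl ∷ []) free
  where
  free : ∀ {s} → s ⊆ w → length s ≡ 3 → All (λ t → sameOrder s t ≡ false) ⟨312⟩
  free {a ∷ b ∷ c ∷ []} s⊆w _ = sameOrder-312⁺ a b c (av a b c s⊆w) ∷ []

-- Occurrences in concatenations and around an inserted minimum

⊆-++⁻ : ∀ (xs : List E) {ys zs} → zs ⊆ xs ++ ys →
        ∃[ as ] ∃[ bs ] (zs ≡ as ++ bs × as ⊆ xs × bs ⊆ ys)
⊆-++⁻ []       τ        = [] , _ , refl , [] , τ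
⊆-++⁻ (x ∷ xs) (_ ∷ʳ τ) =
  let as , bs , eq , τ₁ , τ₂ = ⊆-++⁻ xs τ in as , bs , eq , x ∷ʳ τ₁ , τ₂
⊆-++⁻ (x ∷ xs) (e ∷ τ)  =
  let as , bs , eq , τ₁ , τ₂ = ⊆-++⁻ xs τ in _ ∷ as , bs , cong (_ ∷_) eq , e ∷ τ₁ , τ₂

-- An occurrence either misses the inserted letter or uses it; in the second case the length of `as`
-- tells which role the letter plays.
⊆-insert⁻ : ∀ (xs : List E) {y ys zs} → zs ⊆ xs ++ y ∷ ys →
            zs ⊆ xs ++ ys ⊎ ∃[ as ] ∃[ bs ] (zs ≡ as ++ y ∷ bs × as ⊆ xs × bs ⊆ ys)
⊆-insert⁻ xs τ with ⊆-++⁻ xs τ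
... | as , bs      , refl , τ₁ , _ ∷ʳ τ₂   = inj₁ (++⁺ τ₁ τ₂)
... | as , _ ∷ bs  , refl , τ₁ , refl ∷ τ₂ = inj₂ (as , bs , refl , τ₁ , τ₂)

⊆-insert⁺ : ∀ (xs : List E) {y ys} → xs ++ ys ⊆ xs ++ y ∷ ys
⊆-insert⁺ xs = ++⁺ (⊆-refl {x = xs}) (_ ∷ʳ ⊆-refl)

infix 4 _≪_

_≪_ : List ℕ → List ℕ → Set
A ≪ B = ∀ {a b} → a ∈ A → b ∈ B → a < b

module _ {A B : List ℕ} where

  avoids312-++⁺ : A ≪ B → Avoids312 A → Avoids312 B → Avoids312 (A ++ B)
  avoids312-++⁺ A≪B avA avB a b c s⊆ b≤a b<c with ⊆-++⁻ A s⊆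
  ... | []              , _ , refl , τ₁ , τ₂ = avB a b c τ₂ b≤a b<c
  ... | _ ∷ []          , _ , refl , τ₁ , τ₂ = A≪B (to∈ τ₁) (lookup τ₂ (there (here refl)))
  ... | _ ∷ _ ∷ []      , _ , refl , τ₁ , τ₂ = A≪B (lookup τ₁ (here refl)) (to∈ τ₂)
  ... | _ ∷ _ ∷ _ ∷ []  , _ , refl , τ₁ , τ₂ = avA a b c τ₁ b≤a b<c

  -- The part of the occurrence in A is a prefix. When a lies in A, each of c and d is above a
  -- either because it lies in B, or because a, b and that letter all lie in A, which avoids 312.
  avoidsT₂-++⁺ : A ≪ B → Avoids312 A → AvoidsT₂ B → AvoidsT₂ (A ++ B)
  avoidsT₂-++⁺ A≪B avA avB a b c d s⊆ b≤a b<c b<d with ⊆-++⁻ A s⊆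
  ... | []                 , _ , refl , τ₁ , τ₂ = avB a b c d τ₂ b≤a b<c b<d
  ... | _ ∷ []             , _ , refl , τ₁ , τ₂ =
    A≪B (to∈ τ₁) (lookup τ₂ (there (here refl))) , A≪B (to∈ τ₁) (lookup τ₂ (there (there (here refl))))
  ... | _ ∷ _ ∷ []         , _ , refl , τ₁ , τ₂ =
    A≪B (lookup τ₁ (here refl)) (lookup τ₂ (here refl)) ,
    A≪B (lookup τ₁ (here refl)) (lookup τ₂ (there (here refl)))
  ... | _ ∷ _ ∷ _ ∷ []     , _ , refl , τ₁ , τ₂ =
    avA a b c τ₁ b≤a b<c , A≪B (lookup τ₁ (here refl)) (to∈ τ₂)
  ... | _ ∷ _ ∷ _ ∷ _ ∷ [] , _ , refl , τ₁ , τ₂ =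
    avA a b c (⊆-trans (refl ∷ refl ∷ refl ∷ _ ∷ʳ []) τ₁) b≤a b<c ,
    avA a b d (⊆-trans (refl ∷ refl ∷ _ ∷ʳ refl ∷ []) τ₁) b≤a b<d

avoids312-⊆ : ∀ {v w} → v ⊆ w → Avoids312 w → Avoids312 v
avoids312-⊆ v⊆w av a b c s⊆ = av a b c (⊆-trans s⊆ v⊆w)

avoidsT₂-⊆ : ∀ {v w} → v ⊆ w → AvoidsT₂ w → AvoidsT₂ v
avoidsT₂-⊆ v⊆w av a b c d s⊆ = av a b c d (⊆-trans s⊆ v⊆w)

-- A 312 in A followed by b, which exceeds all of A, would be a 3124.
avoidsT₂⇒avoids312 : ∀ A {b B} → A ≪ b ∷ B → AvoidsT₂ (A ++ b ∷ B) → Avoids312 A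
avoidsT₂⇒avoids312 A {d} A≪B av a b c s⊆ b≤a b<c = proj₁
  (av a b c d (++⁺ s⊆ (refl ∷ minimum _)) b≤a b<c (A≪B (lookup s⊆ (there (here refl))) (here refl)))

module _ (A : List ℕ) {B : List ℕ} {m : ℕ} (m<A : All (m <_) A) (m<B : All (m <_) B) where

  -- The minimum can only be the 1 of a 312, and then the other two letters come from A and from B.
  avoids312-insert⁺ : A ≪ B → Avoids312 (A ++ B) → Avoids312 (A ++ m ∷ B)
  avoids312-insert⁺ A≪B av a b c s⊆ b≤a b<c with ⊆-insert⁻ A s⊆
  ... | inj₁ s⊆′ = av a b c s⊆′ b≤a b<c
  ... | inj₂ ([]         , _ , refl , τ₁ , τ₂) =
    contradiction b≤a (<⇒≱ (All.lookup m<B (lookup τ₂ (here refl))))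
  ... | inj₂ (_ ∷ []     , _ , refl , τ₁ , τ₂) = A≪B (to∈ τ₁) (to∈ τ₂)
  ... | inj₂ (_ ∷ _ ∷ [] , _ , refl , τ₁ , τ₂) =
    contradiction b<c (<-asym (All.lookup m<A (lookup τ₁ (there (here refl)))))
  ... | inj₂ (_ ∷ _ ∷ _ ∷ []    , _ , () , _)
  ... | inj₂ (_ ∷ _ ∷ _ ∷ _ ∷ _ , _ , () , _)

  avoids312⇒≪ : Avoids312 (A ++ m ∷ B) → A ≪ B
  avoids312⇒≪ av a∈ b∈ =
    av _ _ _ (++⁺ (from∈ a∈) (refl ∷ from∈ b∈)) (<⇒≤ (All.lookup m<A a∈)) (All.lookup m<B b∈)

  -- Again the minimum can only be the 1. Then a lies in A and c, d lie in B, so the first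
  -- hypothesis is precisely what such occurrences require.
  avoidsT₂-insert⁺ : (∀ {a c d} → a ∈ A → c ∷ d ∷ [] ⊆ B → a < c × a < d) →
                     AvoidsT₂ (A ++ B) → AvoidsT₂ (A ++ m ∷ B)
  avoidsT₂-insert⁺ h av a b c d s⊆ b≤a b<c b<d with ⊆-insert⁻ A s⊆
  ... | inj₁ s⊆′ = av a b c d s⊆′ b≤a b<c b<d
  ... | inj₂ ([]             , _ , refl , τ₁ , τ₂) =
    contradiction b≤a (<⇒≱ (All.lookup m<B (lookup τ₂ (here refl))))
  ... | inj₂ (_ ∷ []         , _ , refl , τ₁ , τ₂) = h (to∈ τ₁) τ₂
  ... | inj₂ (_ ∷ _ ∷ []     , _ , refl , τ₁ , τ₂) =
    contradiction b<c (<-asym (All.lookup m<A (lookup τ₁ (there (here refl)))))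
  ... | inj₂ (_ ∷ _ ∷ _ ∷ [] , _ , refl , τ₁ , τ₂) =
    contradiction b<d (<-asym (All.lookup m<A (lookup τ₁ (there (here refl)))))
  ... | inj₂ (_ ∷ _ ∷ _ ∷ _ ∷ []    , _ , () , _)
  ... | inj₂ (_ ∷ _ ∷ _ ∷ _ ∷ _ ∷ _ , _ , () , _)

  avoidsT₂-insert⁻ : AvoidsT₂ (A ++ m ∷ B) →
                     ∀ {a c d} → a ∈ A → c ∷ d ∷ [] ⊆ B → a < c × a < d
  avoidsT₂-insert⁻ av a∈ τ = av _ _ _ _ (++⁺ (from∈ a∈) (refl ∷ τ)) (<⇒≤ (All.lookup m<A a∈))
    (All.lookup m<B (lookup τ (here refl))) (All.lookup m<B (lookup τ (there (here refl))))

-- This is where two letters in B matter: each letter of B is then part of a pair c d in B, the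
-- first letter paired with b₂ and every later one with b₁.
avoidsT₂⇒≪ : ∀ A {b₁ b₂ B m} → All (m <_) A → All (m <_) (b₁ ∷ b₂ ∷ B) →
             AvoidsT₂ (A ++ m ∷ b₁ ∷ b₂ ∷ B) → A ≪ b₁ ∷ b₂ ∷ B
avoidsT₂⇒≪ A m<A m<B av a∈ (here refl) =
  proj₁ (avoidsT₂-insert⁻ A m<A m<B av a∈ (refl ∷ refl ∷ minimum _))
avoidsT₂⇒≪ A m<A m<B av a∈ (there b∈) =
  proj₂ (avoidsT₂-insert⁻ A m<A m<B av a∈ (refl ∷ from∈ b∈))

-- Arrangements of intervals

words≡cartesianProductWith : ∀ k m → words (suc k) m ≡ cartesianProductWith _∷_ (upTo m) (words k m)
words≡cartesianProductWith k m = go (upTo m)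
  where
  go : ∀ as → concatMap (λ a → map (a ∷_) (words k m)) as ≡ cartesianProductWith _∷_ as (words k m)
  go []       = refl
  go (a ∷ as) = cong (map (a ∷_) (words k m) ++_) (go as)

words-unique : ∀ k m → Unique (words k m)
words-unique zero    m = [] ∷ []
words-unique (suc k) m rewrite words≡cartesianProductWith k m =
  Unique.cartesianProductWith⁺ _∷_ ∷-injective (Unique.upTo⁺ m) (words-unique k m)

∈-words⁺ : ∀ {m w} → All (_< m) w → w ∈ words (length w) m
∈-words⁺ []                          = here refl
∈-words⁺ {m} {a ∷ w} (a<m ∷ w<m) rewrite words≡cartesianProductWith (length w) m =
  ∈-cartesianProductWith⁺ _∷_ (∈-upTo⁺ a<m) (∈-words⁺ w<m)

∈-words⁻ : ∀ k m {w} → w ∈ words k m → length w ≡ k × All (_< m) w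
∈-words⁻ zero    m (here refl) = refl , []
∈-words⁻ (suc k) m w∈ rewrite words≡cartesianProductWith k m
  with a , w , a∈ , w∈′ , refl ← ∈-cartesianProductWith⁻ _∷_ (upTo m) (words k m) w∈ =
  let len , w<m = ∈-words⁻ k m w∈′ in cong suc len , ∈-upTo⁻ a∈ ∷ w<m

≢⇒≡ᵇ-false : ∀ {a b} → a ≢ b → (a ≡ᵇ b) ≡ false
≢⇒≡ᵇ-false {a} {b} a≢b with a ≡ᵇ b in eq
... | true  = contradiction (≡ᵇ⇒≡ a b (subst T (sym eq) _)) a≢b
... | false = refl

notIn⁺ : ∀ {a w} → All (a ≢_) w → notIn a w ≡ true
notIn⁺ []          = refl
notIn⁺ (a≢b ∷ a∉w) rewrite ≢⇒≡ᵇ-false a≢b = notIn⁺ a∉w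

notIn⁻ : ∀ a w → notIn a w ≡ true → All (a ≢_) w
notIn⁻ a []      eq = []
notIn⁻ a (b ∷ w) eq with a ≡ᵇ b in e
... | false = (λ a≡b → subst T e (≡⇒≡ᵇ a b a≡b)) ∷ notIn⁻ a w eq

distinct⁺ : ∀ {w} → Unique w → distinct w ≡ true
distinct⁺ []         = refl
distinct⁺ (a∉w ∷ u) rewrite notIn⁺ a∉w = distinct⁺ u

distinct⁻ : ∀ w → distinct w ≡ true → Unique w
distinct⁻ []      eq = []
distinct⁻ (a ∷ w) eq with notIn a w in e
... | true = notIn⁻ a w e ∷ distinct⁻ w eq

-- Permutations of the interval from l to l + n - 1. Removing l from such a word, or cutting it into
-- blocks A ≪ B, gives words of the same kind.
record Arranges (l n : ℕ) (w : List ℕ) : Set where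
  constructor arranges
  field
    len    : length w ≡ n
    bounds : All (λ a → l ≤ a × a < l + n) w
    unique : Unique w

open Arranges public

arranges? : ∀ l n w → Dec (Arranges l n w)
arranges? l n w with length w ≟ n ×-dec All.all? (λ a → l ≤? a ×-dec a <? l + n) w ×-dec unique? w
... | yes (p , q , r) = yes (arranges p q r)
... | no ¬pqr         = no λ (arranges p q r) → ¬pqr (p , q , r)

arrangements : ℕ → ℕ → List (List ℕ)
arrangements l n = filter (arranges? l n) (words n (l + n))

arrangements-unique : ∀ l n → Unique (arrangements l n)
arrangements-unique l n = Unique.filter⁺ (arranges? l n) (words-unique n (l + n))

∈-arrangements⁺ : ∀ {l n w} → Arranges l n w → w ∈ arrangements l n
∈-arrangements⁺ {l} {n} {w} ar = ∈-filter⁺ (arranges? l n)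
  (subst (λ k → w ∈ words k (l + n)) (len ar) (∈-words⁺ (All.map proj₂ (bounds ar)))) ar

∈-arrangements⁻ : ∀ l n {w} → w ∈ arrangements l n → Arranges l n w
∈-arrangements⁻ l n w∈ = proj₂ (∈-filter⁻ (arranges? l n) {xs = words n (l + n)} w∈)

∈-perms⁺ : ∀ {n w} → Arranges 0 n w → w ∈ perms n
∈-perms⁺ {n} {w} ar = ∈-filter⁺ (λ w → distinct w ≟ᵇ true)
  (subst (λ k → w ∈ words k n) (len ar) (∈-words⁺ (All.map proj₂ (bounds ar)))) (distinct⁺ (unique ar))

∈-perms⁻ : ∀ n {w} → w ∈ perms n → Arranges 0 n w
∈-perms⁻ n {w} w∈ =
  let w∈′ , d = ∈-filter⁻ (λ w → distinct w ≟ᵇ true) {xs = words n n} w∈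
      len , w<n = ∈-words⁻ n n w∈′
  in arranges len (All.map (λ a<n → z≤n , a<n) w<n) (distinct⁻ w d)

perms-unique : ∀ n → Unique (perms n)
perms-unique n = Unique.filter⁺ (λ w → distinct w ≟ᵇ true) (words-unique n n)

unique-↭ : ∀ {v w : List ℕ} → v ↭ w → Unique v → Unique w
unique-↭ v↭w = ↭ₛ.Unique-resp-↭ (≡.setoid ℕ) (↭⇒↭ₛ v↭w)

arranges-↭ : ∀ {l n v w} → v ↭ w → Arranges l n v → Arranges l n w
arranges-↭ v↭w (arranges len bounds unique) =
  arranges (trans (↭-length (↭-sym v↭w)) len) (All-resp-↭ v↭w bounds) (unique-↭ v↭w unique)

raise : ∀ {l n w} → All (l ≢_) w → All (λ a → l ≤ a × a < l + suc n) w →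
        All (λ a → suc l ≤ a × a < suc l + n) w
raise {l} {n} l∉w bounds = All.zipWith
  (λ { {a} (l≢a , l≤a , a<) → ≤∧≢⇒< l≤a l≢a , subst (a <_) (+-suc l n) a< }) (l∉w , bounds)

-- Induction on the interval: if l occurs it is moved to the front and dropped, and the remaining
-- letters start at l + 1.
pigeonhole : ∀ n l {w} → Unique w → All (λ a → l ≤ a × a < l + n) w → length w ≤ n
pigeonhole zero l {[]} u bounds = z≤n
pigeonhole zero l {a ∷ w} u ((l≤a , a<l+0) ∷ _) =
  contradiction l≤a (<⇒≱ (subst (a <_) (+-identityʳ l) a<l+0))
pigeonhole (suc n) l {w} u bounds with l ∈? w
... | no l∉w = m≤n⇒m≤1+n (pigeonhole n (suc l) u (raise (All.¬Any⇒All¬ w l∉w) bounds))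
... | yes l∈w with A , B , refl ← ∈-∃++ l∈w
  with l∉ ∷ u′ ← unique-↭ (shift l A B) u
  with _ ∷ bounds′ ← All-resp-↭ (shift l A B) bounds =
  subst (_≤ suc n) (sym (↭-length (shift l A B))) (s≤s (pigeonhole n (suc l) u′ (raise l∉ bounds′)))

pigeonhole-between : ∀ {l u w} → l ≤ u → Unique w → All (λ a → l ≤ a × a < u) w → length w + l ≤ u
pigeonhole-between {l} {u} {w} l≤u uniq bounds = begin
  length w + l ≤⟨ +-monoˡ-≤ l (pigeonhole (u ∸ l) l uniq
                    (All.map (λ { {a} (p , q) → p , subst (a <_) (sym (m+[n∸m]≡n l≤u)) q }) bounds)) ⟩
  u ∸ l + l    ≡⟨ m∸n+n≡m l≤u ⟩
  u            ∎
  where open ≤-Reasoning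

arranges-insert⁻ : ∀ {l n} A {B} → Arranges l (suc n) (A ++ l ∷ B) → Arranges (suc l) n (A ++ B)
arranges-insert⁻ {l} A {B} ar
  with arranges len (_ ∷ bounds) (l∉ ∷ unique) ← arranges-↭ (shift l A B) ar =
  arranges (suc-injective len) (raise l∉ bounds) unique

arranges-insert⁺ : ∀ {l n} A {B} → Arranges (suc l) n (A ++ B) → Arranges l (suc n) (A ++ l ∷ B)
arranges-insert⁺ {l} {n} A {B} (arranges len bounds unique) = arranges-↭ (↭-sym (shift l A B))
  (arranges (cong suc len)
    ((≤-refl , m<m+n l (s≤s z≤n)) ∷
      All.map (λ { {a} (p , q) → <⇒≤ p , subst (a <_) (sym (+-suc l n)) q }) bounds)
    (All.map (λ (p , _) → <⇒≢ p) bounds ∷ unique))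

-- Without l, the n + 1 distinct letters would have to fit into n values.
arranges-min : ∀ {l n w} → Arranges l (suc n) w → l ∈ w
arranges-min {l} {n} {w} (arranges len bounds unique) with l ∈? w
... | yes l∈w = l∈w
... | no l∉w  = contradiction
  (subst (_≤ n) len (pigeonhole n (suc l) unique (raise (All.¬Any⇒All¬ w l∉w) bounds))) (<⇒≱ (n<1+n n))

arranges-> : ∀ {l n w} → Arranges (suc l) n w → All (l <_) w
arranges-> ar = All.map proj₁ (bounds ar)

unique-++⁻ : ∀ (A : List ℕ) {B} → Unique (A ++ B) → Unique A × Unique B
unique-++⁻ []      u        = [] , u
unique-++⁻ (a ∷ A) (a∉ ∷ u) =
  let uA , uB = unique-++⁻ A u in All.++⁻ˡ A a∉ ∷ uA , uB

-- For a in A, all of B fits strictly between a and l + n, so counting bounds a from above; for b in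
-- B, all of A fits between l and b, which bounds b from below.
arranges-++⁻ : ∀ {l n} A {B} → A ≪ B → Arranges l n (A ++ B) →
               length A + length B ≡ n × Arranges l (length A) A × Arranges (l + length A) (length B) B
arranges-++⁻ {l} {n} A {B} A≪B (arranges len bounds unique) =
  i+j≡n
  , arranges refl (All.tabulate λ a∈ → proj₁ (inA a∈) , A< a∈) uA
  , arranges refl (All.tabulate λ {b} b∈ → <B b∈ ,
      subst (b <_) (trans (cong (l +_) (sym i+j≡n)) (sym (+-assoc l _ _))) (proj₂ (inB b∈))) uB
  where
  uA = proj₁ (unique-++⁻ A unique)
  uB = proj₂ (unique-++⁻ A unique)
  i+j≡n : length A + length B ≡ n
  i+j≡n = trans (sym (length-++ A)) len
  inA : ∀ {a} → a ∈ A → l ≤ a × a < l + n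
  inA a∈ = All.lookup bounds (∈-++⁺ˡ a∈)
  inB : ∀ {b} → b ∈ B → l ≤ b × b < l + n
  inB b∈ = All.lookup bounds (∈-++⁺ʳ A b∈)
  A< : ∀ {a} → a ∈ A → a < l + length A
  A< {a} a∈ = +-cancelˡ-≤ (length B) (suc a) (l + length A) (begin
    length B + suc a          ≤⟨ pigeonhole-between (proj₂ (inA a∈)) uB
                                   (All.tabulate λ b∈ → A≪B a∈ b∈ , proj₂ (inB b∈)) ⟩
    l + n                     ≡⟨ cong (l +_) i+j≡n ⟨
    l + (length A + length B) ≡⟨ +-assoc l _ _ ⟨
    l + length A + length B   ≡⟨ +-comm _ (length B) ⟩
    length B + (l + length A) ∎)
    where open ≤-Reasoning
  <B : ∀ {b} → b ∈ B → l + length A ≤ b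
  <B {b} b∈ = subst (_≤ b) (+-comm (length A) l)
    (pigeonhole-between (proj₁ (inB b∈)) uA (All.tabulate λ a∈ → proj₁ (inA a∈) , A≪B a∈ b∈))

arranges-≪ : ∀ {l i j A B} → Arranges l i A → Arranges (l + i) j B → A ≪ B
arranges-≪ arA arB a∈ b∈ =
  <-≤-trans (proj₂ (All.lookup (bounds arA) a∈)) (proj₁ (All.lookup (bounds arB) b∈))

arranges-++⁺ : ∀ {l i j A B} → Arranges l i A → Arranges (l + i) j B → Arranges l (i + j) (A ++ B)
arranges-++⁺ {l} {i} {j} {A} arA arB = arranges
  (trans (length-++ A) (cong₂ _+_ (len arA) (len arB)))
  (All.++⁺
    (All.map (λ (p , q) → p , <-≤-trans q (+-monoʳ-≤ l (m≤m+n i j))) (bounds arA))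
    (All.map (λ { {b} (p , q) → ≤-trans (m≤m+n l i) p , subst (b <_) (+-assoc l i j) q }) (bounds arB)))
  (Unique.++⁺ (unique arA) (unique arB) λ (a∈ , b∈) → <-irrefl refl (arranges-≪ arA arB a∈ b∈))

-- Letters of A and A′ exceed m, so the first m in the word marks the cut.
insert-injective : ∀ {m : ℕ} A A′ {B B′} → All (m <_) A → All (m <_) A′ →
                   A ++ m ∷ B ≡ A′ ++ m ∷ B′ → A ≡ A′ × B ≡ B′
insert-injective []      []       p       p′       eq = refl , ∷-injectiveʳ eq
insert-injective []      (_ ∷ A′) p       (q ∷ p′) eq = contradiction (∷-injectiveˡ eq) (<⇒≢ q)
insert-injective (_ ∷ A) []       (q ∷ p) p′       eq = contradiction (sym (∷-injectiveˡ eq)) (<⇒≢ q)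
insert-injective (_ ∷ A) (_ ∷ A′) (_ ∷ p) (_ ∷ p′) eq =
  let a≡ , rest = ∷-injective eq ; A≡ , B≡ = insert-injective A A′ p p′ rest in cong₂ _∷_ a≡ A≡ , B≡

-- Decomposition at the minimum

-- The ascents of m ∷ w for a letter m below w.
asc⁺ : List ℕ → ℕ
asc⁺ []        = 0
asc⁺ w@(_ ∷ _) = suc (asc w)

lastStep : List ℕ → Maybe Bool
lastStep []                  = nothing
lastStep (_ ∷ [])            = nothing
lastStep (a ∷ b ∷ [])        = just (a <ᵇ b)
lastStep (_ ∷ w@(_ ∷ _ ∷ _)) = lastStep w

node : ℕ → List ℕ → List ℕ → List ℕ
node m A B = A ++ m ∷ B

insertBeforeLast : ℕ → List ℕ → List ℕ
insertBeforeLast m []            = m ∷ []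
insertBeforeLast m (b ∷ [])      = m ∷ b ∷ []
insertBeforeLast m (a ∷ b ∷ w)   = a ∷ insertBeforeLast m (b ∷ w)

-- A new minimum m placed last creates a final descent (false), placed last but one a final ascent (true).
attach : Bool → ℕ → List ℕ → List ℕ
attach false m w = w ++ m ∷ []
attach true  m w = insertBeforeLast m w

-- The number of letters that follow the new minimum.
attached : Bool → ℕ
attached e = if e then 1 else 0

insertBeforeLast-++ : ∀ m A b → insertBeforeLast m (A ++ b ∷ []) ≡ A ++ m ∷ b ∷ []
insertBeforeLast-++ m []           b = refl
insertBeforeLast-++ m (a ∷ [])     b = refl
insertBeforeLast-++ m (a ∷ a′ ∷ A) b = cong (a ∷_) (insertBeforeLast-++ m (a′ ∷ A) b)

attach-++ : ∀ e m A {B} → length B ≡ attached e → attach e m (A ++ B) ≡ node m A B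
attach-++ false m A {[]}     _ = cong (_++ m ∷ []) (++-identityʳ A)
attach-++ true  m A {b ∷ []} _ = insertBeforeLast-++ m A b

attach-view : ∀ e (w : List ℕ) → 0 < length w → ∃[ A ] ∃[ B ] (w ≡ A ++ B × length B ≡ attached e)
attach-view false w           _ = w , [] , sym (++-identityʳ w) , refl
attach-view true  (b ∷ [])    _ = [] , b ∷ [] , refl , refl
attach-view true  (a ∷ b ∷ w) _ =
  let A , B , w≡ , len = attach-view true (b ∷ w) (s≤s z≤n) in a ∷ A , B , cong (a ∷_) w≡ , len

lastStep-++ : ∀ A {x y B} → lastStep (A ++ x ∷ y ∷ B) ≡ lastStep (x ∷ y ∷ B)
lastStep-++ []                = refl
lastStep-++ (a ∷ [])          = refl
lastStep-++ (a ∷ a′ ∷ [])     = refl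
lastStep-++ (a ∷ a′ ∷ a″ ∷ A) = lastStep-++ (a′ ∷ a″ ∷ A)

lastStep-just : ∀ a b w → ∃[ e ] lastStep (a ∷ b ∷ w) ≡ just e
lastStep-just a b []      = (a <ᵇ b) , refl
lastStep-just a b (c ∷ w) = lastStep-just b c w

lastStep-node : ∀ e m A {B} → All (m <_) A → All (m <_) B → length B ≡ attached e →
                0 < length (A ++ B) → lastStep (node m A B) ≡ just e
lastStep-node false m (a ∷ [])          {[]}     (m<a ∷ _) _         _   _ =
  cong just (<ᵇ-false (<⇒≤ m<a))
lastStep-node false m (a ∷ a′ ∷ [])     {[]}     (_ ∷ p)   q         len _ =
  lastStep-node false m (a′ ∷ []) p q len (s≤s z≤n)
lastStep-node false m (a ∷ a′ ∷ a″ ∷ A) {[]}     (_ ∷ p)   q         len _ =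
  lastStep-node false m (a′ ∷ a″ ∷ A) p q len (s≤s z≤n)
lastStep-node true  m A                 {b ∷ []} _         (m<b ∷ _) _   _ =
  trans (lastStep-++ A) (cong just (<ᵇ-true m<b))

-- The step into m is a descent, and the step out of m, if B is nonempty, an ascent.
asc-node : ∀ {m} A {B} → All (m <_) A → All (m <_) B → asc (node m A B) ≡ asc A + asc⁺ B
asc-node []           {[]}    p         q         = refl
asc-node []           {b ∷ B} p         (m<b ∷ _) rewrite <ᵇ-true m<b = refl
asc-node (a ∷ [])     {B}     (m<a ∷ _) q         rewrite <ᵇ-false (<⇒≤ m<a) = asc-node [] [] q
asc-node (a ∷ a′ ∷ A) {B}     (_ ∷ p)   q         =
  trans (cong (_ +_) (asc-node (a′ ∷ A) p q)) (sym (+-assoc (if a <ᵇ a′ then 1 else 0) _ _))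

-- The last step gives way to a descent into m and an ascent out of it: a final ascent is merely
-- replaced, a final descent turns into one ascent more.
asc-insertBeforeLast : ∀ {e m} w → All (m <_) w → lastStep w ≡ just e →
                       asc (insertBeforeLast m w) ≡ (if e then 0 else 1) + asc w
asc-insertBeforeLast (a ∷ b ∷ [])    (m<a ∷ m<b ∷ []) refl
  rewrite <ᵇ-false (<⇒≤ m<a) | <ᵇ-true m<b with a <ᵇ b
... | true  = refl
... | false = refl
asc-insertBeforeLast {e} {m} (a ∷ b ∷ c ∷ w) (_ ∷ p) eq = trans
  (cong (_ +_) (asc-insertBeforeLast (b ∷ c ∷ w) p eq))
  (x∙yz≈y∙xz (if a <ᵇ b then 1 else 0) (if e then 0 else 1) _)

avoids312? : ∀ w → Dec (avoidsAll ⟨312⟩ w ≡ true)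
avoids312? w = avoidsAll ⟨312⟩ w ≟ᵇ true

avoidsT₂? : ∀ w → Dec (avoidsAll T₂ w ≡ true)
avoidsT₂? w = avoidsAll T₂ w ≟ᵇ true

lastStep? : ∀ e w → Dec (lastStep w ≡ just e)
lastStep? e w = ≡-dec _≟ᵇ_ (lastStep w) (just e)

𝒫 : ℕ → ℕ → List (List ℕ)
𝒫 l n = filter avoids312? (arrangements l n)

-- Words of length at most 1 have no last step, so they lie in neither ℰ true l n nor ℰ false l n.
ℰ : Bool → ℕ → ℕ → List (List ℕ)
ℰ e l n = filter (lastStep? e) (filter avoidsT₂? (arrangements l n))

singleton : ℕ → ℕ → List (List ℕ)
singleton l 1 = (l ∷ []) ∷ []
singleton l _ = []

-- All nonempty avoiders, in the three classes counted by x, P and Q.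
ℰ⁺ : ℕ → ℕ → List (List ℕ)
ℰ⁺ l n = singleton l n ++ (ℰ true l n ++ ℰ false l n)

∈-𝒫⁺ : ∀ {l n w} → Arranges l n w → Avoids312 w → w ∈ 𝒫 l n
∈-𝒫⁺ ar av = ∈-filter⁺ avoids312? (∈-arrangements⁺ ar) (avoids312⁺ av)

∈-𝒫⁻ : ∀ l n {w} → w ∈ 𝒫 l n → Arranges l n w × Avoids312 w
∈-𝒫⁻ l n w∈ =
  let w∈′ , av = ∈-filter⁻ avoids312? {xs = arrangements l n} w∈ in ∈-arrangements⁻ l n w∈′ , avoids312⁻ av

𝒫-unique : ∀ l n → Unique (𝒫 l n)
𝒫-unique l n = Unique.filter⁺ avoids312? (arrangements-unique l n)

∈-ℰ⁺ : ∀ {e l n w} → Arranges l n w → AvoidsT₂ w → lastStep w ≡ just e → w ∈ ℰ e l n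
∈-ℰ⁺ {e} ar av st = ∈-filter⁺ (lastStep? e) (∈-filter⁺ avoidsT₂? (∈-arrangements⁺ ar) (avoidsT₂⁺ av)) st

∈-ℰ⁻ : ∀ e l n {w} → w ∈ ℰ e l n → Arranges l n w × AvoidsT₂ w × lastStep w ≡ just e
∈-ℰ⁻ e l n w∈ =
  let w∈′ , st = ∈-filter⁻ (lastStep? e) {xs = filter avoidsT₂? (arrangements l n)} w∈
      w∈″ , av = ∈-filter⁻ avoidsT₂? {xs = arrangements l n} w∈′
  in ∈-arrangements⁻ l n w∈″ , avoidsT₂⁻ av , st

ℰ-unique : ∀ e l n → Unique (ℰ e l n)
ℰ-unique e l n = Unique.filter⁺ (lastStep? e) (Unique.filter⁺ avoidsT₂? (arrangements-unique l n))

singleton-unique : ∀ l n → Unique (singleton l n)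
singleton-unique l zero          = []
singleton-unique l (suc zero)    = [] ∷ []
singleton-unique l (suc (suc n)) = []

∈-singleton⁻ : ∀ l n {w} → w ∈ singleton l n → n ≡ 1 × w ≡ l ∷ []
∈-singleton⁻ l (suc zero) (here refl) = refl , refl

∈-ℰ⁺⁺ : ∀ {l n w} → Arranges l n w → AvoidsT₂ w → 0 < length w → w ∈ ℰ⁺ l n
∈-ℰ⁺⁺ {l} {w = a ∷ []} (arranges refl ((l≤a , a<) ∷ []) u) av _
  rewrite ≤-antisym l≤a (≤-pred (subst (a <_) (+-comm l 1) a<)) = here refl
∈-ℰ⁺⁺ {l} {n} {a ∷ b ∷ w} ar av _ with lastStep-just a b w
... | true  , st = ∈-++⁺ʳ (singleton l n) (∈-++⁺ˡ (∈-ℰ⁺ ar av st))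
... | false , st = ∈-++⁺ʳ (singleton l n) (∈-++⁺ʳ (ℰ true l n) (∈-ℰ⁺ ar av st))

lastStep⇒nonempty : ∀ {e} w → lastStep w ≡ just e → 0 < length w
lastStep⇒nonempty (_ ∷ _) _ = s≤s z≤n

∈-ℰ⁺⁻ : ∀ l n {w} → w ∈ ℰ⁺ l n → Arranges l n w × AvoidsT₂ w × 0 < length w
∈-ℰ⁺⁻ l n {w} w∈ with ∈-++⁻ (singleton l n) w∈
... | inj₁ w∈₁ with refl , refl ← ∈-singleton⁻ l n w∈₁ =
  arranges refl ((≤-refl , subst (l <_) (+-comm 1 l) ≤-refl) ∷ []) ([] ∷ [])
  , (λ { _ _ _ _ (_ ∷ ()) ; _ _ _ _ (_ ∷ʳ ()) }) , s≤s z≤n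
... | inj₂ w∈₂ with ∈-++⁻ (ℰ true l n) w∈₂
... | inj₁ w∈₃ = let ar , av , st = ∈-ℰ⁻ true l n w∈₃ in ar , av , lastStep⇒nonempty w st
... | inj₂ w∈₃ = let ar , av , st = ∈-ℰ⁻ false l n w∈₃ in ar , av , lastStep⇒nonempty w st

ℰ⁺-unique : ∀ l n → Unique (ℰ⁺ l n)
ℰ⁺-unique l n = Unique.++⁺ (singleton-unique l n)
  (Unique.++⁺ (ℰ-unique true l n) (ℰ-unique false l n) λ (p , q) → true≢false
    (trans (sym (proj₂ (proj₂ (∈-ℰ⁻ true l n p)))) (proj₂ (proj₂ (∈-ℰ⁻ false l n q)))))
  λ (p , q) → disjoint (∈-singleton⁻ l n p) (∈-++⁻ (ℰ true l n) q)
  where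
  true≢false : just true ≡ just false → ⊥
  true≢false ()
  disjoint : ∀ {w} → n ≡ 1 × w ≡ l ∷ [] → w ∈ ℰ true l n ⊎ w ∈ ℰ false l n → ⊥
  disjoint (_ , refl) (inj₁ q) = contradiction (proj₂ (proj₂ (∈-ℰ⁻ true l n q))) λ ()
  disjoint (_ , refl) (inj₂ q) = contradiction (proj₂ (proj₂ (∈-ℰ⁻ false l n q))) λ ()

lower : ∀ {l i j w} → Arranges (suc l + i) j w → All (l <_) w
lower {l} {i} ar = All.map (≤-trans (s≤s (m≤m+n l i)) ∘ proj₁) (bounds ar)

𝒫-product : ℕ → ℕ → List (List ℕ)
𝒫-product l n = product (node l) (𝒫 (suc l)) (λ i → 𝒫 (suc l + i)) n

-- The case |B| ≥ 2: having a last step forces two letters in B, and that step is also the last one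
-- of the whole word.
ℰ-product : Bool → ℕ → ℕ → List (List ℕ)
ℰ-product e l n = product (node l) (𝒫 (suc l)) (λ i → ℰ e (suc l + i)) n

node-injective : ∀ {l i i′ j j′ A A′ B B′} → Arranges (suc l) i A → Arranges (suc l + i) j B →
  Arranges (suc l) i′ A′ → Arranges (suc l + i′) j′ B′ →
  node l A B ≡ node l A′ B′ → i ≡ i′ × A ≡ A′ × B ≡ B′
node-injective {A = A} {A′} arA arB arA′ arB′ eq =
  let A≡ , B≡ = insert-injective A A′ (arranges-> arA) (arranges-> arA′) eq
  in trans (sym (len arA)) (trans (cong length A≡) (len arA′)) , A≡ , B≡

𝒫-product-unique : ∀ l n → Unique (𝒫-product l n)
𝒫-product-unique l n = unique-product (node l) n
  (λ {i} {j} {i′} {j′} a b a′ b′ → node-injective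
    (proj₁ (∈-𝒫⁻ (suc l) i a)) (proj₁ (∈-𝒫⁻ (suc l + i) j b))
    (proj₁ (∈-𝒫⁻ (suc l) i′ a′)) (proj₁ (∈-𝒫⁻ (suc l + i′) j′ b′)))
  (𝒫-unique (suc l)) (λ i → 𝒫-unique (suc l + i))

ℰ-product-unique : ∀ e l n → Unique (ℰ-product e l n)
ℰ-product-unique e l n = unique-product (node l) n
  (λ {i} {j} {i′} {j′} a b a′ b′ → node-injective
    (proj₁ (∈-𝒫⁻ (suc l) i a)) (proj₁ (∈-ℰ⁻ e (suc l + i) j b))
    (proj₁ (∈-𝒫⁻ (suc l) i′ a′)) (proj₁ (∈-ℰ⁻ e (suc l + i′) j′ b′)))
  (𝒫-unique (suc l)) (λ i → ℰ-unique e (suc l + i))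

𝒫⇒product : ∀ l n {w} → w ∈ 𝒫 l (suc n) → w ∈ 𝒫-product l n
𝒫⇒product l n w∈
  with ar , av ← ∈-𝒫⁻ l (suc n) w∈
  with A , B , refl ← ∈-∃++ (arranges-min ar)
  with ar′ ← arranges-insert⁻ A ar
  with l<A , l<B ← All.++⁻ A (arranges-> ar′)
  with A≪B ← avoids312⇒≪ A l<A l<B av
  with refl , arA , arB ← arranges-++⁻ A A≪B ar′ =
  ∈-product⁺ (node l) (length A) (length B)
    (∈-𝒫⁺ arA (avoids312-⊆ (++⁺ʳ (l ∷ B) ⊆-refl) av))
    (∈-𝒫⁺ arB (avoids312-⊆ (++⁺ˡ A (l ∷ʳ ⊆-refl)) av))

product⇒𝒫 : ∀ l n {w} → w ∈ 𝒫-product l n → w ∈ 𝒫 l (suc n)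
product⇒𝒫 l n w∈
  with i , j , A , B , refl , A∈ , B∈ , refl ← ∈-product⁻ (node l) (𝒫 (suc l)) _ n w∈
  with arA , avA ← ∈-𝒫⁻ (suc l) i A∈ | arB , avB ← ∈-𝒫⁻ (suc l + i) j B∈ =
  ∈-𝒫⁺ (arranges-insert⁺ A (arranges-++⁺ arA arB))
    (avoids312-insert⁺ A (arranges-> arA) (lower arB) (arranges-≪ arA arB)
      (avoids312-++⁺ (arranges-≪ arA arB) avA avB))

-- The case |B| ≤ 1: the required last step e fixes |B|, while A B may be any nonempty avoider,
-- whatever its own last step. An empty A B would leave one letter and no last step.
ℰ-attached : Bool → ℕ → ℕ → List (List ℕ)
ℰ-attached e l n = map (attach e l) (ℰ⁺ (suc l) n)

∈-ℰ-attached⁺ : ∀ e {l n} A {B} → length B ≡ attached e → 0 < length (A ++ B) →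
  Arranges l (suc n) (node l A B) → AvoidsT₂ (node l A B) → node l A B ∈ ℰ-attached e l n
∈-ℰ-attached⁺ e {l} {n} A {B} lenB ne ar av = subst (_∈ ℰ-attached e l n) (attach-++ e l A lenB)
  (∈-map⁺ (attach e l) (∈-ℰ⁺⁺ (arranges-insert⁻ A ar) (avoidsT₂-⊆ (⊆-insert⁺ A) av) ne))

nonempty : ∀ (A : List ℕ) {b B} → 0 < length (A ++ b ∷ B)
nonempty []      = s≤s z≤n
nonempty (_ ∷ _) = s≤s z≤n

ℰ⇒ : ∀ e l n {w} → w ∈ ℰ e l (suc n) → w ∈ ℰ-attached e l n ++ ℰ-product e l n
ℰ⇒ e l n w∈
  with ar , av , st ← ∈-ℰ⁻ e l (suc n) w∈
  with A , B , refl ← ∈-∃++ (arranges-min ar)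
  with ar′ ← arranges-insert⁻ A ar
  with l<A , l<B ← All.++⁻ A (arranges-> ar′) = go e A B st ar av ar′ l<A l<B
  where
  go : ∀ e A B → lastStep (node l A B) ≡ just e → Arranges l (suc n) (node l A B) →
       AvoidsT₂ (node l A B) → Arranges (suc l) n (A ++ B) → All (l <_) A → All (l <_) B →
       node l A B ∈ ℰ-attached e l n ++ ℰ-product e l n
  -- If A were empty too, the word would consist of l alone and have no last step.
  go e (a ∷ A) [] st ar av ar′ l<A l<B
    with refl ← just-injective (trans (sym (lastStep-node false l (a ∷ A) l<A l<B refl (s≤s z≤n))) st) =
    ∈-++⁺ˡ (∈-ℰ-attached⁺ false (a ∷ A) refl (s≤s z≤n) ar av)
  go e A (b ∷ []) st ar av ar′ l<A l<B
    with refl ← just-injective (trans (sym (lastStep-node true l A l<A l<B refl (nonempty A))) st) =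
    ∈-++⁺ˡ (∈-ℰ-attached⁺ true A refl (nonempty A) ar av)
  go e A B@(b ∷ b′ ∷ _) st ar av ar′ l<A l<B
    with A≪B ← avoidsT₂⇒≪ A l<A l<B av
    with refl , arA , arB ← arranges-++⁻ A A≪B ar′ =
    ∈-++⁺ʳ (ℰ-attached e l n) (∈-product⁺ (node l) (length A) (length B)
      (∈-𝒫⁺ arA (avoidsT₂⇒avoids312 A A≪B (avoidsT₂-⊆ (⊆-insert⁺ A) av)))
      (∈-ℰ⁺ arB (avoidsT₂-⊆ (++⁺ˡ A (l ∷ʳ ⊆-refl)) av) (trans (sym (lastStep-++ A)) st)))

∈-ℰ-attached⁻ : ∀ e l n {w} → w ∈ ℰ-attached e l n →
  ∃[ A ] ∃[ B ] (w ≡ node l A B × length B ≡ attached e × A ++ B ∈ ℰ⁺ (suc l) n)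
∈-ℰ-attached⁻ e l n w∈
  with v , v∈ , refl ← ∈-map⁻ (attach e l) {xs = ℰ⁺ (suc l) n} w∈
  with A , B , refl , lenB ← attach-view e v (proj₂ (proj₂ (∈-ℰ⁺⁻ (suc l) n {v} v∈))) =
  A , B , attach-++ e l A lenB , lenB , v∈

attached≤1 : ∀ e → attached e ≤ 1
attached≤1 true  = ≤-refl
attached≤1 false = z≤n

attached⇒ℰ : ∀ e l n {w} → w ∈ ℰ-attached e l n → w ∈ ℰ e l (suc n)
attached⇒ℰ e l n w∈
  with A , B , refl , lenB , AB∈ ← ∈-ℰ-attached⁻ e l n w∈
  with ar , av , ne ← ∈-ℰ⁺⁻ (suc l) n AB∈
  with l<A , l<B ← All.++⁻ A (arranges-> ar) =
  ∈-ℰ⁺ (arranges-insert⁺ A ar)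
    (avoidsT₂-insert⁺ A l<A l<B
      -- B has at most one letter, so it contains no pair c d and the condition is vacuous.
      (λ _ cd⊆ → contradiction (subst (2 ≤_) lenB (length-mono-≤ cd⊆)) (<⇒≱ (s≤s (attached≤1 e)))) av)
    (lastStep-node e l A l<A l<B lenB ne)

2≤length : ∀ {e} w → lastStep w ≡ just e → 2 ≤ length w
2≤length (_ ∷ _ ∷ _) _ = s≤s (s≤s z≤n)

lastStep-insert : ∀ A {m B e} → lastStep B ≡ just e → lastStep (node m A B) ≡ just e
lastStep-insert A {B = _ ∷ _ ∷ _} st = trans (lastStep-++ A) st

product⇒ℰ : ∀ e l n {w} → w ∈ ℰ-product e l n → w ∈ ℰ e l (suc n)
product⇒ℰ e l n w∈
  with i , j , A , B , refl , A∈ , B∈ , refl ← ∈-product⁻ (node l) (𝒫 (suc l)) _ n w∈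
  with arA , avA ← ∈-𝒫⁻ (suc l) i A∈ | arB , avB , st ← ∈-ℰ⁻ e (suc l + i) j B∈ =
  ∈-ℰ⁺ (arranges-insert⁺ A (arranges-++⁺ arA arB))
    (avoidsT₂-insert⁺ A (arranges-> arA) (lower arB)
      (λ a∈ cd⊆ → A≪B a∈ (lookup cd⊆ (here refl)) , A≪B a∈ (lookup cd⊆ (there (here refl))))
      (avoidsT₂-++⁺ A≪B avA avB))
    (lastStep-insert A st)
  where
  A≪B = arranges-≪ arA arB

-- The position of l recovers A and B. The two lists are disjoint because B has at most one letter
-- in the first and at least two in the second.
ℰ-split-unique : ∀ e l n → Unique (ℰ-attached e l n ++ ℰ-product e l n)
ℰ-split-unique e l n = Unique.++⁺ (unique-map (attach e l) attach-injective (ℰ⁺-unique (suc l) n))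
  (ℰ-product-unique e l n) λ (p , q) → disjoint p q
  where
  attach-injective : ∀ {v v′} → v ∈ ℰ⁺ (suc l) n → v′ ∈ ℰ⁺ (suc l) n →
                     attach e l v ≡ attach e l v′ → v ≡ v′
  attach-injective {v} {v′} v∈ v′∈ eq
    with arv , _ , ne ← ∈-ℰ⁺⁻ (suc l) n v∈ | arv′ , _ , ne′ ← ∈-ℰ⁺⁻ (suc l) n v′∈
    with A , B , refl , lenB ← attach-view e v ne | A′ , B′ , refl , lenB′ ← attach-view e v′ ne′ =
    uncurry (cong₂ _++_) (insert-injective A A′ (All.++⁻ˡ A (arranges-> arv)) (All.++⁻ˡ A′ (arranges-> arv′))
      (trans (sym (attach-++ e l A lenB)) (trans eq (attach-++ e l A′ lenB′))))
  disjoint : ∀ {w} → w ∈ ℰ-attached e l n → w ∈ ℰ-product e l n → ⊥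
  disjoint p q
    with A , B , refl , lenB , AB∈ ← ∈-ℰ-attached⁻ e l n p
    with i , j , A′ , B′ , _ , A′∈ , B′∈ , eq ← ∈-product⁻ (node l) (𝒫 (suc l)) _ n q
    with _ , refl ← insert-injective A A′ (All.++⁻ˡ A (arranges-> (proj₁ (∈-ℰ⁺⁻ (suc l) n AB∈))))
                      (arranges-> (proj₁ (∈-𝒫⁻ (suc l) i A′∈))) eq =
    <⇒≱ (s≤s (attached≤1 e)) (subst (2 ≤_) lenB (2≤length B (proj₂ (proj₂ (∈-ℰ⁻ e (suc l + i) j B′∈)))))

-- Recurrences

asc⁺-suc : ∀ w → 0 < length w → asc⁺ w ≡ suc (asc w)
asc⁺-suc (_ ∷ _) _ = refl

asc⁺-node : ∀ {m} A {B} → All (m <_) A → All (m <_) B → asc⁺ (node m A B) ≡ suc (asc A) + asc⁺ B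
asc⁺-node {m} A {B} p q = trans (asc⁺-suc (node m A B) (nonempty A)) (cong suc (asc-node A p q))

𝒫-recurrence : ∀ l n {f g} →
  (∀ i → i ≤ n → gf (suc ∘ asc) (𝒫 (suc l) i) S₁.≋ f i) →
  (∀ i j → j ≤ n → gf asc⁺ (𝒫 (suc l + i) j) S₁.≋ g j) →
  gf asc⁺ (𝒫 l (suc n)) S₁.≋ (f S₂.✶ g) n
𝒫-recurrence l n {f} {g} p q k = trans
  (count-≐ _ (𝒫-unique l (suc n)) (𝒫-product-unique l n) (𝒫⇒product l n) (product⇒𝒫 l n))
  (gf-product (node l) asc⁺ (suc ∘ asc) asc⁺ n
    (λ {i} {j} {A} A∈ B∈ → asc⁺-node A (arranges-> (proj₁ (∈-𝒫⁻ (suc l) i A∈)))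
                             (lower (proj₁ (∈-𝒫⁻ (suc l + i) j B∈))))
    p q k)

-- On 312-avoiders `asc⁺` behaves like `peak` and one plus `asc` like `peak⁺`: both pairs add up
-- over the decomposition in the same way, and the members of a pair differ only on the empty
-- object, with values 0 and 1. The bound m serves strong induction for all l at once.
𝒫≋N : ∀ m n → n ≤ m → ∀ l → gf asc⁺ (𝒫 l n) S₁.≋ N n × gf (suc ∘ asc) (𝒫 l n) S₁.≋ N⁺ n
𝒫≋N m       zero    _         l = (λ k → refl) , (λ k → refl)
𝒫≋N (suc m) (suc n) (s≤s n≤m) l = eq , λ k → trans (suc∘asc k) (trans (eq k) (sym (N⁺-suc n k)))
  where
  eq : gf asc⁺ (𝒫 l (suc n)) S₁.≋ N (suc n)
  eq k = trans
    (𝒫-recurrence l n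
      (λ i i≤n → proj₂ (𝒫≋N m i (≤-trans i≤n n≤m) (suc l)))
      (λ i j j≤n → proj₁ (𝒫≋N m j (≤-trans j≤n n≤m) (suc l + i))) k)
    (sym (N-recurrence n k))
  suc∘asc : gf (suc ∘ asc) (𝒫 l (suc n)) S₁.≋ gf asc⁺ (𝒫 l (suc n))
  suc∘asc = gf-cong (suc ∘ asc) asc⁺ (𝒫 l (suc n)) λ {w} w∈ → sym (asc⁺-suc w
    (subst (0 <_) (sym (len (proj₁ (∈-𝒫⁻ l (suc n) w∈)))) (s≤s z≤n)))

gf-singleton : ∀ l n → gf asc (singleton l n) S₁.≋ S₂.X n
gf-singleton l zero          k = refl
gf-singleton l (suc zero)    k = trans (+-identityʳ _) (mono-0 k)
gf-singleton l (suc (suc n)) k = refl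

gf-ℰ⁺ : ∀ (st : List ℕ → ℕ) l n → gf st (ℰ⁺ l n) S₁.≋
        gf st (singleton l n) S₁.∔ (gf st (ℰ true l n) S₁.∔ gf st (ℰ false l n))
gf-ℰ⁺ st l n k = trans (gf-++ st (singleton l n) _ k)
  (cong (gf st (singleton l n) k +_) (gf-++ st (ℰ true l n) (ℰ false l n) k))

-- The brackets x + P + Q and y x + P + y Q of the overview; a factor y marks the words that gain an
-- ascent from the new minimum.
attachedSeries : Bool → (Bool → Series) → Series
attachedSeries false g n = S₂.X n S₁.∔ (g true n S₁.∔ g false n)
attachedSeries true  g n = (mono 1 S₁.✶ S₂.X n) S₁.∔ (g true n S₁.∔ (mono 1 S₁.✶ g false n))

gf-attached : ∀ e l n {g} → (∀ e → gf asc (ℰ e (suc l) n) S₁.≋ g e n) →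
              gf asc (ℰ-attached e l n) S₁.≋ attachedSeries e g n
gf-attached e l n {g} h k = trans (gf-map asc (attach e l) (ℰ⁺ (suc l) n) k)
  (trans (gf-ℰ⁺ (asc ∘ attach e l) (suc l) n k) (parts e))
  where
  bump : ∀ (xs : List (List ℕ)) {f} → gf asc xs S₁.≋ f → gf (suc ∘ asc) xs S₁.≋ mono 1 S₁.✶ f
  bump xs {f} p k = trans (gf-suc asc xs k) (S₁.✶-cong {f = mono 1} (λ _ → refl) p k)

  ℰ> : ∀ e {w} → w ∈ ℰ e (suc l) n → All (l <_) w
  ℰ> e w∈ = arranges-> (proj₁ (∈-ℰ⁻ e (suc l) n w∈))

  ends : ∀ e {w} → w ∈ ℰ e (suc l) n → lastStep w ≡ just e
  ends e w∈ = proj₂ (proj₂ (∈-ℰ⁻ e (suc l) n w∈))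

  singleton-attach : ∀ e {w} → w ∈ singleton (suc l) n → asc (attach e l w) ≡ attached e + asc w
  singleton-attach e w∈ with e | ∈-singleton⁻ (suc l) n w∈
  ... | true  | _ , refl rewrite <ᵇ-true (≤-refl {suc l}) = refl
  ... | false | _ , refl rewrite <ᵇ-false (<⇒≤ (≤-refl {suc l})) = refl

  append : ∀ {w} → All (l <_) w → asc (w ++ l ∷ []) ≡ asc w
  append {w} l<w = trans (asc-node w l<w []) (+-identityʳ _)

  part : ∀ {st xs} st′ {f} → (∀ {w} → w ∈ xs → st w ≡ st′ w) → gf st′ xs S₁.≋ f → gf st xs k ≡ f k
  part {st} {xs} st′ p q = trans (gf-cong st st′ xs p k) (q k)

  parts : ∀ e → (gf (asc ∘ attach e l) (singleton (suc l) n) S₁.∔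
           (gf (asc ∘ attach e l) (ℰ true (suc l) n) S₁.∔ gf (asc ∘ attach e l) (ℰ false (suc l) n))) k
          ≡ attachedSeries e g n k
  parts false = cong₂ _+_ (part asc (singleton-attach false) (gf-singleton (suc l) n))
    (cong₂ _+_ (part asc (append ∘ ℰ> true) (h true)) (part asc (append ∘ ℰ> false) (h false)))
  parts true = cong₂ _+_
    (part (suc ∘ asc) (singleton-attach true) (bump (singleton (suc l) n) (gf-singleton (suc l) n)))
    (cong₂ _+_
      (part asc (λ {w} w∈ → asc-insertBeforeLast w (ℰ> true w∈) (ends true w∈)) (h true))
      (part (suc ∘ asc) (λ {w} w∈ → asc-insertBeforeLast w (ℰ> false w∈) (ends false w∈))
        (bump (ℰ false (suc l) n) (h false))))

ℰ-recurrence : ∀ e l n {g} → (∀ e l j → j ≤ n → gf asc (ℰ e l j) S₁.≋ g e j) →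
               gf asc (ℰ e l (suc n)) S₁.≋ attachedSeries e g n S₁.∔ (N⁺ S₂.✶ g e) n
ℰ-recurrence e l n {g} h k = begin
  gf asc (ℰ e l (suc n)) k
    ≡⟨ count-≐ _ (ℰ-unique e l (suc n)) (ℰ-split-unique e l n) (ℰ⇒ e l n)
         (λ w∈ → [ attached⇒ℰ e l n , product⇒ℰ e l n ]′ (∈-++⁻ (ℰ-attached e l n) w∈)) ⟩
  gf asc (ℰ-attached e l n ++ ℰ-product e l n) k
    ≡⟨ gf-++ asc (ℰ-attached e l n) _ k ⟩
  gf asc (ℰ-attached e l n) k + gf asc (ℰ-product e l n) k
    ≡⟨ cong₂ _+_ (gf-attached e l n (λ e → h e (suc l) n ≤-refl) k)
         (gf-product (node l) asc (suc ∘ asc) asc n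
           (λ {i} {j} {A} {B} A∈ B∈ → weight i j A B A∈ B∈)
           (λ i _ → proj₂ (𝒫≋N i i ≤-refl (suc l))) (λ i j j≤n → h e (suc l + i) j j≤n) k) ⟩
  attachedSeries e g n k + (N⁺ S₂.✶ g e) n k ∎
  where
  open ≡.≡-Reasoning
  -- B is nonempty here, and the ascent from l into B is credited to the factor A, which therefore
  -- contributes `N⁺`.
  weight : ∀ i j A B → A ∈ 𝒫 (suc l) i → B ∈ ℰ e (suc l + i) j → asc (node l A B) ≡ suc (asc A) + asc B
  weight i j A B A∈ B∈ =
    let arB , _ , st = ∈-ℰ⁻ e (suc l + i) j B∈ in
    trans (asc-node A (arranges-> (proj₁ (∈-𝒫⁻ (suc l) i A∈))) (lower arB))
      (trans (cong (asc A +_) (asc⁺-suc B (lastStep⇒nonempty B st))) (+-suc (asc A) (asc B)))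

ℰ-series : Bool → Series
ℰ-series e n = gf asc (ℰ e 0 n)

-- The recurrence for `ℰ e l` does not involve l apart from smaller instances, so induction on size
-- gives translation invariance without a relabelling bijection.
ℰ-shift : ∀ m n → n ≤ m → ∀ e l → gf asc (ℰ e l n) S₁.≋ ℰ-series e n
ℰ-shift m       zero    _         e l k = refl
ℰ-shift (suc m) (suc n) (s≤s n≤m) e l k =
  trans (ℰ-recurrence e l n h k) (sym (ℰ-recurrence e 0 n h k))
  where
  h : ∀ e l j → j ≤ n → gf asc (ℰ e l j) S₁.≋ ℰ-series e j
  h e l j j≤n = ℰ-shift m j (≤-trans j≤n n≤m) e l

∈-avoiders⁺ : ∀ {n w} → Arranges 0 n w → AvoidsT₂ w → w ∈ avoiders n
∈-avoiders⁺ ar av = ∈-filter⁺ avoidsT₂? (∈-perms⁺ ar) (avoidsT₂⁺ av)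

∈-avoiders⁻ : ∀ n {w} → w ∈ avoiders n → Arranges 0 n w × AvoidsT₂ w
∈-avoiders⁻ n w∈ =
  let w∈′ , av = ∈-filter⁻ avoidsT₂? {xs = perms n} w∈ in ∈-perms⁻ n w∈′ , avoidsT₂⁻ av

M≋ : M S₂.≋ S₂.X S₂.∔ ℰ-series true S₂.∔ ℰ-series false
M≋ zero    k = refl
M≋ (suc n) k = begin
  gf asc (avoiders (suc n)) k
    ≡⟨ count-≐ _ (Unique.filter⁺ avoidsT₂? (perms-unique (suc n))) (ℰ⁺-unique 0 (suc n))
         (λ w∈ → let ar , av = ∈-avoiders⁻ (suc n) w∈ in
           ∈-ℰ⁺⁺ ar av (subst (0 <_) (sym (len ar)) (s≤s z≤n)))
         (λ w∈ → let ar , av , _ = ∈-ℰ⁺⁻ 0 (suc n) w∈ in ∈-avoiders⁺ ar av) ⟩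
  gf asc (ℰ⁺ 0 (suc n)) k
    ≡⟨ gf-ℰ⁺ asc 0 (suc n) k ⟩
  gf asc (singleton 0 (suc n)) k + (P + Q)
    ≡⟨ cong (_+ (P + Q)) (gf-singleton 0 (suc n) k) ⟩
  S₂.X (suc n) k + (P + Q)
    ≡⟨ +-assoc (S₂.X (suc n) k) P Q ⟨
  S₂.X (suc n) k + P + Q ∎
  where
  open ≡.≡-Reasoning
  P = ℰ-series true (suc n) k
  Q = ℰ-series false (suc n) k

-- The functional equation

Y : Series
Y = S₂.const (mono 1)

-- The series K of the overview: `N` without the empty path.
N₊ : Series
N₊ zero    k = 0
N₊ (suc n) k = N (suc n) k

N≋1+N₊ : N S₂.≋ S₂.const (S₁.const 1) S₂.∔ N₊
N≋1+N₊ zero    k = cong (_+ 0) (mono-0 k)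
N≋1+N₊ (suc n) k = refl

N⁺≋Y+N₊ : N⁺ S₂.≋ Y S₂.∔ N₊
N⁺≋Y+N₊ zero    k = refl
N⁺≋Y+N₊ (suc n) k = N⁺-suc n k

N⁺-✶ : ∀ f n → (N⁺ S₂.✶ f) n S₁.≋ (S₂.X S₂.✶ ((Y S₂.∔ N₊) S₂.✶ f)) (suc n)
N⁺-✶ f n k = trans (S₂.✶-cong {g = f} N⁺≋Y+N₊ (λ _ _ → refl) n k)
  (sym (S₂.X-✶-suc ((Y S₂.∔ N₊) S₂.✶ f) n k))

N₊-eq : N₊ S₂.≋ S₂.X S₂.✶ ((Y S₂.∔ N₊) S₂.✶ N)
N₊-eq zero    k = sym (S₂.X-✶-zero ((Y S₂.∔ N₊) S₂.✶ N) k)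
N₊-eq (suc n) k = trans (N-recurrence n k) (N⁺-✶ N n k)

-- The parameter `h` lets each bracket be supplied in the algebraic form that the elimination
-- expects.
ℰ-equation : ∀ e h → (∀ n → attachedSeries e ℰ-series n S₁.≋ h n) →
  ℰ-series e S₂.≋ S₂.X S₂.✶ h S₂.∔ S₂.X S₂.✶ ((Y S₂.∔ N₊) S₂.✶ ℰ-series e)
ℰ-equation e h p zero    k = sym (cong₂ _+_ (S₂.X-✶-zero h k)
  (S₂.X-✶-zero ((Y S₂.∔ N₊) S₂.✶ ℰ-series e) k))
ℰ-equation e h p (suc n) k = trans
  (ℰ-recurrence e 0 n (λ e l j _ → ℰ-shift j j ≤-refl e l) k)
  (cong₂ _+_ (trans (p n k) (sym (S₂.X-✶-suc h n k))) (N⁺-✶ (ℰ-series e) n k))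

theorem20 : M ≈ (X· N ⊕ (X· (N ⊛ N) ⊛ M))
theorem20 n k = begin
  M n k
    ≡⟨ eliminate S₂.X Y N N₊ M (ℰ-series true) (ℰ-series false)
         (λ g h → S₂.fixpoint-unique g {h}) N≋1+N₊ N₊-eq M≋
         -- The bracket for a final descent, x + P + Q, is `M` itself.
         (ℰ-equation false M λ n k → trans
           (sym (+-assoc (S₂.X n k) (ℰ-series true n k) (ℰ-series false n k))) (sym (M≋ n k)))
         (ℰ-equation true (Y S₂.✶ S₂.X S₂.∔ ℰ-series true S₂.∔ Y S₂.✶ ℰ-series false) λ n k → trans
           (sym (+-assoc ((mono 1 S₁.✶ S₂.X n) k) (ℰ-series true n k) _))
           (cong₂ _+_ (cong (_+ ℰ-series true n k) (sym (S₂.const-✶ (mono 1) S₂.X n k)))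
             (sym (S₂.const-✶ (mono 1) (ℰ-series false) n k))))
         n k ⟩
  (S₂.X S₂.✶ N) n k + (S₂.X S₂.✶ (N S₂.✶ N) S₂.✶ M) n k
    ≡⟨ cong₂ _+_ (X-✶₂≡X· N n k) (trans
         (S₂.✶-cong {g = M} (λ n k → trans (X-✶₂≡X· (N S₂.✶ N) n k) (X·-cong (✶₂≡⊛ N N) n k))
           (λ _ _ → refl) n k)
         (✶₂≡⊛ (X· (N ⊛ N)) M n k)) ⟩
  (X· N ⊕ (X· (N ⊛ N) ⊛ M)) n k ∎
  where
  open ≡.≡-Reasoning
  open Elimination S₂.commutativeSemiring using (eliminate)
  X·-cong : ∀ {f g} → f ≈ g → X· f ≈ X· g
  X·-cong p zero    k = refl
  X·-cong p (suc n) k = p n k
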